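{- Every cosimple zonotope has lattice-width three or more. Conversely, if $Z=\sum_{i=1}^n[\mathbf 0,\mathbf u_i]$ is a lattice $d$-zonotope of lattice-width three or more, $Z$ is not a parallelepiped, and its generators $\mathbf u_1,\dots,\mathbf u_n\in\mathbb{Z}^d$ span the lattice $\mathbb{Z}^d$ (over $\mathbb{Z}$), then $Z$ is cosimple.
   Context: A lattice $d$-zonotope is a $d$-dimensional zonotope in $\mathbb{R}^d$ with finitely many generators in $\mathbb{Z}^d$. A finite collection of vectors $\mathbf u_1,\dots,\mathbf u_n\in\mathbb{Z}^d$ that linearly spans $\mathbb{R}^d$ is cosimple if there is a linear dependence $\sum_i\lambda_i\mathbf u_i=\mathbf 0$ whose coefficients are all non-zero and have pairwise different absolute values; a zonotope $\sum_i[\mathbf 0,\mathbf u_i]$ is cosimple if its collection of generators is. The lattice-width of a convex body $C\subseteq\mathbb{R}^d$ is the minimum, over $\mathbf z\in\mathbb{Z}^d\setminus\{\mathbf 0\}$, of $\max_{\mathbf x\in C}\mathbf z^\intercal\mathbf x-\min_{\mathbf x\in C}\mathbf z^\intercal\mathbf x$. -}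

module Defs where

open import Algebra.Bundles.Raw using (RawMonoid)
import Algebra.Definitions.RawMonoid as RawSum
open import Data.Fin.Base using (Fin)
open import Data.Integer.Base as ℤ using (ℤ)
open import Data.Nat.Base as ℕ using (ℕ; _⊔_)
import Data.Nat.Properties as ℕ
open import Data.Product.Base using (_×_; _,_; ∃)
open import Data.Sum.Base using (inj₁; inj₂)
open import Data.Rational.Base as ℚ using (ℚ; 0ℚ; 1ℚ; ½)
import Data.Rational.Properties as ℚ
open import Data.Rational.Solver using (module +-*-Solver)
open import Data.Vec.Functional using (Vector)
open import Relation.Binary.PropositionalEquality
  using (_≡_; _≢_; refl; sym; cong; cong₂; subst; module ≡-Reasoning)
open import Relation.Nullary.Negation.Core using (¬_)
open import Relation.Unary using (Pred; _≐_)
open import Level using (0ℓ)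

------------------------------------------------------------------------
-- Real numbers: Cauchy sequences of rationals, equal when their
-- difference tends to 0. All operations are computed termwise.

Eventually : Pred ℕ 0ℓ → Set
Eventually P = ∃ λ N → ∀ n → N ℕ.≤ n → P n

Cauchy : (ℕ → ℚ) → Set
Cauchy x = ∀ ε → 0ℚ ℚ.< ε →
  ∃ λ N → ∀ m n → N ℕ.≤ m → N ℕ.≤ n → ℚ.∣ x m ℚ.- x n ∣ ℚ.< ε

record ℝ : Set where
  constructor mkℝ
  field
    seq    : ℕ → ℚ
    cauchy : Cauchy seq

open ℝ public

infix  4 _≈_ _≤_
infix  8 -_
infixl 7 _*_
infixl 6 _+_ _-_

_≈_ : ℝ → ℝ → Set
x ≈ y = ∀ ε → 0ℚ ℚ.< ε →
  Eventually λ n → ℚ.∣ seq x n ℚ.- seq y n ∣ ℚ.< ε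

_≤_ : ℝ → ℝ → Set
x ≤ y = ∀ ε → 0ℚ ℚ.< ε → Eventually λ n → seq x n ℚ.< seq y n ℚ.+ ε

private
  Bounded : (ℕ → ℚ) → Set
  Bounded x = ∃ λ B → ℚ.Positive B × Eventually λ n → ℚ.∣ x n ∣ ℚ.≤ B

  abstract
    half : ∀ {ε} → 0ℚ ℚ.< ε → 0ℚ ℚ.< ½ ℚ.* ε
    half = ℚ.*-monoʳ-<-pos ½

    half+half : ∀ ε → ½ ℚ.* ε ℚ.+ ½ ℚ.* ε ≡ ε
    half+half = solve 1 (λ e → con ½ :* e :+ con ½ :* e := e) refl
      where open +-*-Solver

    const-cauchy : ∀ q → Cauchy (λ _ → q)
    const-cauchy q ε 0<ε = 0 , λ _ _ _ _ →
      subst (ℚ._< ε) (sym (cong ℚ.∣_∣ (ℚ.+-inverseʳ q))) 0<ε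

    +-cauchy : ∀ x y → Cauchy x → Cauchy y → Cauchy (λ n → x n ℚ.+ y n)
    +-cauchy x y cx cy ε 0<ε =
      let (N₁ , p) = cx (½ ℚ.* ε) (half 0<ε)
          (N₂ , q) = cy (½ ℚ.* ε) (half 0<ε)
      in N₁ ⊔ N₂ , λ m n m≥ n≥ → begin-strict
        ℚ.∣ (x m ℚ.+ y m) ℚ.- (x n ℚ.+ y n) ∣
          ≡⟨ cong ℚ.∣_∣ (rearrange (x m) (y m) (x n) (y n)) ⟩
        ℚ.∣ (x m ℚ.- x n) ℚ.+ (y m ℚ.- y n) ∣
          ≤⟨ ℚ.∣p+q∣≤∣p∣+∣q∣ (x m ℚ.- x n) (y m ℚ.- y n) ⟩
        ℚ.∣ x m ℚ.- x n ∣ ℚ.+ ℚ.∣ y m ℚ.- y n ∣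
          <⟨ ℚ.+-mono-< (p m n (ℕ.m⊔n≤o⇒m≤o N₁ N₂ m≥) (ℕ.m⊔n≤o⇒m≤o N₁ N₂ n≥))
                        (q m n (ℕ.m⊔n≤o⇒n≤o N₁ N₂ m≥) (ℕ.m⊔n≤o⇒n≤o N₁ N₂ n≥)) ⟩
        ½ ℚ.* ε ℚ.+ ½ ℚ.* ε
          ≡⟨ half+half ε ⟩
        ε ∎
      where
      open ℚ.≤-Reasoning
      rearrange : ∀ a b c d →
        (a ℚ.+ b) ℚ.- (c ℚ.+ d) ≡ (a ℚ.- c) ℚ.+ (b ℚ.- d)
      rearrange = solve 4 (λ a b c d →
        (a :+ b) :- (c :+ d) := (a :- c) :+ (b :- d)) refl
        where open +-*-Solver

    neg-cauchy : ∀ x → Cauchy x → Cauchy (λ n → ℚ.- x n)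
    neg-cauchy x cx ε 0<ε =
      let (N , p) = cx ε 0<ε
      in N , λ m n m≥ n≥ →
        subst (λ a → ℚ.∣ a ∣ ℚ.< ε) (swap (x n) (x m)) (p n m n≥ m≥)
      where
      swap : ∀ a b → a ℚ.- b ≡ ℚ.- b ℚ.- ℚ.- a
      swap = solve 2 (λ a b → a :- b := :- b :- (:- a)) refl
        where open +-*-Solver

    ∣p∣≤∣p-q∣+∣q∣ : ∀ p q → ℚ.∣ p ∣ ℚ.≤ ℚ.∣ p ℚ.- q ∣ ℚ.+ ℚ.∣ q ∣
    ∣p∣≤∣p-q∣+∣q∣ p q = subst (λ a → ℚ.∣ a ∣ ℚ.≤ ℚ.∣ p ℚ.- q ∣ ℚ.+ ℚ.∣ q ∣)
      (cancel p q) (ℚ.∣p+q∣≤∣p∣+∣q∣ (p ℚ.- q) q)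
      where
      cancel : ∀ p q → (p ℚ.- q) ℚ.+ q ≡ p
      cancel = solve 2 (λ p q → (p :- q) :+ q := p) refl
        where open +-*-Solver

    ∣∣-lipschitz : ∀ p q → ℚ.∣ ℚ.∣ p ∣ ℚ.- ℚ.∣ q ∣ ∣ ℚ.≤ ℚ.∣ p ℚ.- q ∣
    ∣∣-lipschitz p q with ℚ.∣p∣≡p∨∣p∣≡-p (ℚ.∣ p ∣ ℚ.- ℚ.∣ q ∣)
    ... | inj₁ eq = begin
        ℚ.∣ ℚ.∣ p ∣ ℚ.- ℚ.∣ q ∣ ∣           ≡⟨ eq ⟩
        ℚ.∣ p ∣ ℚ.- ℚ.∣ q ∣                 ≤⟨ ℚ.+-monoˡ-≤ (ℚ.- ℚ.∣ q ∣) (∣p∣≤∣p-q∣+∣q∣ p q) ⟩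
        ℚ.∣ p ℚ.- q ∣ ℚ.+ ℚ.∣ q ∣ ℚ.- ℚ.∣ q ∣ ≡⟨ cancel ℚ.∣ p ℚ.- q ∣ ℚ.∣ q ∣ ⟩
        ℚ.∣ p ℚ.- q ∣                       ∎
      where
      open ℚ.≤-Reasoning
      cancel : ∀ a b → a ℚ.+ b ℚ.- b ≡ a
      cancel = solve 2 (λ a b → a :+ b :- b := a) refl
        where open +-*-Solver
    ... | inj₂ eq = begin
        ℚ.∣ ℚ.∣ p ∣ ℚ.- ℚ.∣ q ∣ ∣           ≡⟨ eq ⟩
        ℚ.- (ℚ.∣ p ∣ ℚ.- ℚ.∣ q ∣)           ≡⟨ flip ℚ.∣ p ∣ ℚ.∣ q ∣ ⟩
        ℚ.∣ q ∣ ℚ.- ℚ.∣ p ∣                 ≤⟨ ℚ.+-monoˡ-≤ (ℚ.- ℚ.∣ p ∣) (∣p∣≤∣p-q∣+∣q∣ q p) ⟩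
        ℚ.∣ q ℚ.- p ∣ ℚ.+ ℚ.∣ p ∣ ℚ.- ℚ.∣ p ∣ ≡⟨ cancel ℚ.∣ q ℚ.- p ∣ ℚ.∣ p ∣ ⟩
        ℚ.∣ q ℚ.- p ∣                       ≡⟨ ℚ.∣-p∣≡∣p∣ (q ℚ.- p) ⟨
        ℚ.∣ ℚ.- (q ℚ.- p) ∣                 ≡⟨ cong ℚ.∣_∣ (flip q p) ⟩
        ℚ.∣ p ℚ.- q ∣                       ∎
      where
      open ℚ.≤-Reasoning
      flip : ∀ a b → ℚ.- (a ℚ.- b) ≡ b ℚ.- a
      flip = solve 2 (λ a b → :- (a :- b) := b :- a) refl
        where open +-*-Solver
      cancel : ∀ a b → a ℚ.+ b ℚ.- b ≡ a
      cancel = solve 2 (λ a b → a :+ b :- b := a) refl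
        where open +-*-Solver

    ∣∣-cauchy : ∀ x → Cauchy x → Cauchy (λ n → ℚ.∣ x n ∣)
    ∣∣-cauchy x cx ε 0<ε =
      let (N , p) = cx ε 0<ε
      in N , λ m n m≥ n≥ →
        ℚ.≤-<-trans (∣∣-lipschitz (x m) (x n)) (p m n m≥ n≥)

    bounded : ∀ x → Cauchy x → Bounded x
    bounded x cx =
      let (N , p) = cx 1ℚ (ℚ.positive⁻¹ 1ℚ)
      in 1ℚ ℚ.+ ℚ.∣ x N ∣
       , ℚ.positive (ℚ.+-mono-<-≤ (ℚ.positive⁻¹ 1ℚ) (ℚ.0≤∣p∣ (x N)))
       , N , λ n n≥ → ℚ.≤-trans (∣p∣≤∣p-q∣+∣q∣ (x n) (x N))
           (ℚ.+-monoˡ-≤ ℚ.∣ x N ∣ (ℚ.<⇒≤ (p n N n≥ ℕ.≤-refl)))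

    -- Every positive ε is B times a positive rational.
    quotient : ∀ B .{{_ : ℚ.Positive B}} {ε} → 0ℚ ℚ.< ε →
      ∃ λ δ → 0ℚ ℚ.< δ × B ℚ.* δ ≡ ε
    quotient B {ε} 0<ε =
        B⁻¹ ℚ.* ε
      , subst (ℚ._< B⁻¹ ℚ.* ε) (ℚ.*-zeroʳ B⁻¹)
          (ℚ.*-monoʳ-<-pos B⁻¹ {{ℚ.1/pos⇒pos B}} 0<ε)
      , (begin
          B ℚ.* (B⁻¹ ℚ.* ε) ≡⟨ ℚ.*-assoc B B⁻¹ ε ⟨
          B ℚ.* B⁻¹ ℚ.* ε   ≡⟨ cong (ℚ._* ε) (ℚ.*-inverseʳ B {{ℚ.pos⇒nonZero B}}) ⟩
          1ℚ ℚ.* ε          ≡⟨ ℚ.*-identityˡ ε ⟩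
          ε                 ∎)
      where
      open ≡-Reasoning
      B⁻¹ : ℚ
      B⁻¹ = (ℚ.1/ B) {{ℚ.pos⇒nonZero B}}

    *-bound : ∀ B .{{_ : ℚ.Positive B}} {p q δ} →
      ℚ.∣ p ∣ ℚ.≤ B → ℚ.∣ q ∣ ℚ.< δ → ℚ.∣ p ℚ.* q ∣ ℚ.< B ℚ.* δ
    *-bound B {p} {q} {δ} p≤B q<δ = begin-strict
      ℚ.∣ p ℚ.* q ∣         ≡⟨ ℚ.∣p*q∣≡∣p∣*∣q∣ p q ⟩
      ℚ.∣ p ∣ ℚ.* ℚ.∣ q ∣   ≤⟨ ℚ.*-monoʳ-≤-nonNeg ℚ.∣ q ∣ {{ℚ.∣-∣-nonNeg q}} p≤B ⟩
      B ℚ.* ℚ.∣ q ∣         <⟨ ℚ.*-monoʳ-<-pos B q<δ ⟩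
      B ℚ.* δ               ∎
      where open ℚ.≤-Reasoning

    *-cauchy : ∀ x y → Cauchy x → Cauchy y → Cauchy (λ n → x n ℚ.* y n)
    *-cauchy x y cx cy ε 0<ε
      = let (B , B>0 , K , x≤B) = bounded x cx
            (C , C>0 , L , y≤C) = bounded y cy
            (δ , 0<δ , Bδ≡)     = quotient B {{B>0}} (half 0<ε)
            (γ , 0<γ , Cγ≡)     = quotient C {{C>0}} (half 0<ε)
            (M , p)             = cy δ 0<δ
            (N , q)             = cx γ 0<γ
        in (K ⊔ L) ⊔ (M ⊔ N) , λ m n m≥ n≥ →
        let KL≤m = ℕ.m⊔n≤o⇒m≤o (K ⊔ L) (M ⊔ N) m≥
            KL≤n = ℕ.m⊔n≤o⇒m≤o (K ⊔ L) (M ⊔ N) n≥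
            MN≤m = ℕ.m⊔n≤o⇒n≤o (K ⊔ L) (M ⊔ N) m≥
            MN≤n = ℕ.m⊔n≤o⇒n≤o (K ⊔ L) (M ⊔ N) n≥
        in begin-strict
        ℚ.∣ x m ℚ.* y m ℚ.- x n ℚ.* y n ∣
          ≡⟨ cong ℚ.∣_∣ (rearrange (x m) (y m) (x n) (y n)) ⟩
        ℚ.∣ x m ℚ.* (y m ℚ.- y n) ℚ.+ y n ℚ.* (x m ℚ.- x n) ∣
          ≤⟨ ℚ.∣p+q∣≤∣p∣+∣q∣ (x m ℚ.* (y m ℚ.- y n)) (y n ℚ.* (x m ℚ.- x n)) ⟩
        ℚ.∣ x m ℚ.* (y m ℚ.- y n) ∣ ℚ.+ ℚ.∣ y n ℚ.* (x m ℚ.- x n) ∣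
          <⟨ ℚ.+-mono-<
               (*-bound B {{B>0}} {x m} {y m ℚ.- y n} (x≤B m (ℕ.m⊔n≤o⇒m≤o K L KL≤m))
                 (p m n (ℕ.m⊔n≤o⇒m≤o M N MN≤m) (ℕ.m⊔n≤o⇒m≤o M N MN≤n)))
               (*-bound C {{C>0}} {y n} {x m ℚ.- x n} (y≤C n (ℕ.m⊔n≤o⇒n≤o K L KL≤n))
                 (q m n (ℕ.m⊔n≤o⇒n≤o M N MN≤m) (ℕ.m⊔n≤o⇒n≤o M N MN≤n))) ⟩
        B ℚ.* δ ℚ.+ C ℚ.* γ
          ≡⟨ cong₂ ℚ._+_ Bδ≡ Cγ≡ ⟩
        ½ ℚ.* ε ℚ.+ ½ ℚ.* ε
          ≡⟨ half+half ε ⟩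
        ε ∎
      where
      open ℚ.≤-Reasoning
      rearrange : ∀ a b c d →
        a ℚ.* b ℚ.- c ℚ.* d ≡ a ℚ.* (b ℚ.- d) ℚ.+ d ℚ.* (a ℚ.- c)
      rearrange = solve 4 (λ a b c d →
        a :* b :- c :* d := a :* (b :- d) :+ d :* (a :- c)) refl
        where open +-*-Solver

fromℤ : ℤ → ℝ
fromℤ k = mkℝ (λ _ → k ℚ./ 1) (const-cauchy (k ℚ./ 1))

0ℝ 1ℝ 3ℝ : ℝ
0ℝ = fromℤ (ℤ.+ 0)
1ℝ = fromℤ (ℤ.+ 1)
3ℝ = fromℤ (ℤ.+ 3)

_+_ _*_ : ℝ → ℝ → ℝ
x + y = mkℝ (λ n → seq x n ℚ.+ seq y n) (+-cauchy (seq x) (seq y) (cauchy x) (cauchy y))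
x * y = mkℝ (λ n → seq x n ℚ.* seq y n) (*-cauchy (seq x) (seq y) (cauchy x) (cauchy y))

-_ : ℝ → ℝ
- x = mkℝ (λ n → ℚ.- seq x n) (neg-cauchy (seq x) (cauchy x))

_-_ : ℝ → ℝ → ℝ
x - y = x + (- y)

∣_∣ : ℝ → ℝ
∣ x ∣ = mkℝ (λ n → ℚ.∣ seq x n ∣) (∣∣-cauchy (seq x) (cauchy x))

+-0-rawMonoid : RawMonoid 0ℓ 0ℓ
+-0-rawMonoid = record { Carrier = ℝ ; _≈_ = _≈_ ; _∙_ = _+_ ; ε = 0ℝ }

∑ : ∀ {n} → Vector ℝ n → ℝ
∑ = RawSum.sum +-0-rawMonoid

∑ℤ : ∀ {n} → Vector ℤ n → ℤ
∑ℤ = RawSum.sum ℤ.+-0-rawMonoid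

------------------------------------------------------------------------
-- Linear algebra in ℝ^d and ℤ^d

ℝ^ ℤ^ : ℕ → Set
ℝ^ d = Vector ℝ d
ℤ^ d = Vector ℤ d

infix 4 _≈ᵛ_

_≈ᵛ_ : ∀ {d} → ℝ^ d → ℝ^ d → Set
x ≈ᵛ y = ∀ j → x j ≈ y j

0ᵛ : ∀ {d} → ℝ^ d
0ᵛ _ = 0ℝ

ι : ∀ {d} → ℤ^ d → ℝ^ d
ι z j = fromℤ (z j)

lincomb : ∀ {d n} → Vector ℝ n → Vector (ℝ^ d) n → ℝ^ d
lincomb c v j = ∑ λ i → c i * v i j

infix 8 _·_

_·_ : ∀ {d} → ℤ^ d → ℝ^ d → ℝ
z · x = ∑ λ j → ι z j * x j

Spansℝ : ∀ {d n} → Vector (ℝ^ d) n → Set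
Spansℝ {d} {n} v = ∀ (x : ℝ^ d) → ∃ λ (c : Vector ℝ n) → lincomb c v ≈ᵛ x

Spansℤ : ∀ {d n} → Vector (ℤ^ d) n → Set
Spansℤ {d} {n} u = ∀ (z : ℤ^ d) → ∃ λ (c : Vector ℤ n) →
  ∀ j → ∑ℤ (λ i → c i ℤ.* u i j) ≡ z j

LinearlyIndependent : ∀ {d n} → Vector (ℝ^ d) n → Set
LinearlyIndependent {d} {n} v = ∀ (c : Vector ℝ n) → lincomb c v ≈ᵛ 0ᵛ → ∀ i → c i ≈ 0ℝ

Nonzero : ∀ {d} → ℤ^ d → Set
Nonzero z = ¬ (∀ j → z j ≡ ℤ.+ 0)

record Cosimple {d n} (u : Vector (ℤ^ d) n) : Set where
  field
    spans    : Spansℝ (λ i → ι (u i))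
    coeff    : Vector ℝ n
    relation : lincomb coeff (λ i → ι (u i)) ≈ᵛ 0ᵛ
    nonzero  : ∀ i → ¬ coeff i ≈ 0ℝ
    distinct : ∀ i j → i ≢ j → ¬ ∣ coeff i ∣ ≈ ∣ coeff j ∣

------------------------------------------------------------------------
-- Zonotopes as subsets of ℝ^d

zonotope : ∀ {d n} → Vector (ℝ^ d) n → Pred (ℝ^ d) 0ℓ
zonotope {d} {n} v x = ∃ λ (t : Vector ℝ n) →
  (∀ i → 0ℝ ≤ t i × t i ≤ 1ℝ) × x ≈ᵛ lincomb t v

latticeZonotope : ∀ {d n} → Vector (ℤ^ d) n → Pred (ℝ^ d) 0ℓ
latticeZonotope u = zonotope λ i → ι (u i)

affineHull : ∀ {d} → Pred (ℝ^ d) 0ℓ → Pred (ℝ^ d) 0ℓ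
affineHull {d} C x = ∃ λ k → ∃ λ (p : Vector (ℝ^ d) k) → ∃ λ (a : Vector ℝ k) →
  (∀ i → C (p i)) × ∑ a ≈ 1ℝ × x ≈ᵛ lincomb a p

FullDimensional : ∀ {d} → Pred (ℝ^ d) 0ℓ → Set
FullDimensional C = ∀ x → affineHull C x

-- A translate of a zonotope with d linearly independent real generators;
-- this is a property of the set C, not of a chosen list of generators.
IsParallelepiped : ∀ {d} → Pred (ℝ^ d) 0ℓ → Set
IsParallelepiped {d} C = ∃ λ (p : ℝ^ d) → ∃ λ (w : Vector (ℝ^ d) d) →
  LinearlyIndependent w × C ≐ (λ x → zonotope w λ j → x j - p j)

------------------------------------------------------------------------
-- Lattice-width

IsMax IsMin : ∀ {d} → Pred (ℝ^ d) 0ℓ → (ℝ^ d → ℝ) → ℝ → Set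
IsMax C f M = (∃ λ x → C x × f x ≈ M) × (∀ x → C x → f x ≤ M)
IsMin C f m = (∃ λ x → C x × f x ≈ m) × (∀ x → C x → m ≤ f x)

IsWidthAlong : ∀ {d} → Pred (ℝ^ d) 0ℓ → ℤ^ d → ℝ → Set
IsWidthAlong C z w =
  ∃ λ M → ∃ λ m → IsMax C (z ·_) M × IsMin C (z ·_) m × w ≈ M - m

IsLatticeWidth : ∀ {d} → Pred (ℝ^ d) 0ℓ → ℝ → Set
IsLatticeWidth C w =
    (∃ λ z → Nonzero z × IsWidthAlong C z w)
  × (∀ z → Nonzero z → ∀ w′ → IsWidthAlong C z w′ → w ≤ w′)

-- The lattice-width exists (the minimum is attained) and is at least r.
LatticeWidth≥ : ∀ {d} → Pred (ℝ^ d) 0ℓ → ℝ → Set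
LatticeWidth≥ C r = ∃ λ w → IsLatticeWidth C w × r ≤ w

module Submission where

-- The width of the zonotope along z is the integer ∑ᵢ |z·uᵢ|, the ℓ¹-norm of
-- (z·uᵢ)ᵢ. Coefficients λᵢ are non-zero with distinct absolute values exactly
-- when no non-zero integer vector of ℓ¹-norm at most 2 is orthogonal to λ, such
-- a vector being ±eᵢ, ±2eᵢ or ±eᵢ ± eⱼ.
--
-- If λ is a cosimple relation, then (z·uᵢ)ᵢ is orthogonal to λ, and it is
-- non-zero for z ≠ 0 because the generators span; hence its norm is at least 3.
-- Spanning also bounds z by its width, so the minimum is over a finite box.
--
-- Conversely, when the generators span ℤ^d, an integer vector ℓ that is
-- orthogonal to all integer relations has the form ℓᵢ = z·uᵢ with z integral.
-- Width at least 3 thus excludes every non-zero ℓ of norm at most 2, and an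
-- integer relation avoiding the finitely many hyperplanes orthogonal to these ℓ
-- is obtained from the powers of a large integer.

open import Defs
open import Algebra.Bundles using (CommutativeSemiring; CommutativeRing)
import Algebra.Properties.Semiring.Sum as SemiringSum
open import Data.Bool.Base using (if_then_else_)
open import Data.Fin.Base using (Fin; zero; suc; toℕ; fromℕ<; punchIn)
import Data.Fin.Properties as Fin
open import Data.Integer.Base as ℤ using (ℤ; +_; -[1+_])
import Data.Integer.Properties as ℤ
open import Data.Nat.Base as ℕ using (ℕ; zero; suc; NonZero)
open import Data.Nat.Induction using (Acc; acc; <-wellFounded)
import Data.Nat.Properties as ℕ
open import Data.Product.Base using (_×_; _,_; ∃; proj₁; proj₂)
open import Data.Rational.Base as ℚ using (ℚ; 0ℚ; 1ℚ; ½)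
import Data.Rational.Properties as ℚ
open import Data.Rational.Solver using (module +-*-Solver)
import Data.Rational.Unnormalised.Base as ℚᵘ
import Data.Rational.Unnormalised.Properties as ℚᵘ
open import Data.Sum.Base using (_⊎_; inj₁; inj₂; [_,_]′)
open import Data.Vec.Functional using (Vector; []; _∷_)
open import Function.Base using (_∘_)
open import Level using (0ℓ)
open import Relation.Binary.Bundles using (Preorder)
open import Relation.Binary.PropositionalEquality
  using (_≡_; _≢_; _≗_; refl; sym; trans; cong; cong₂; subst; subst₂; module ≡-Reasoning)
open import Relation.Nullary.Decidable
  using (Dec; yes; no; does; dec-true; dec-false; map′; ¬?; _⊎-dec_; _×-dec_)
open import Relation.Nullary.Negation.Core using (¬_; contradiction)
open import Relation.Unary using (Pred)

-- Finite sums in commutative semirings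

module SumLemmas {a ℓ} (R : CommutativeSemiring a ℓ) where
  private module R = CommutativeSemiring R
  open R using (Carrier; 0#; 1#) renaming (_≈_ to _≋_; _+_ to _⊕_; _*_ to _⊗_)
  open SemiringSum R.semiring public
  open import Relation.Binary.Reasoning.Setoid R.setoid

  sum-zero : ∀ {n} {f : Vector Carrier n} → (∀ i → f i ≋ 0#) → sum f ≋ 0#
  sum-zero {n} f≈0 = R.trans (sum-cong-≋ f≈0) (sum-replicate-zero n)

  -- Associativity (xM)y = x(My) for a row vector `x`, a matrix `M` and a column vector `y`.
  sum-*-assoc : ∀ {m n} (x : Vector Carrier m) (M : Fin m → Vector Carrier n)
    (y : Vector Carrier n) →
    sum (λ j → sum (λ i → x i ⊗ M i j) ⊗ y j) ≋ sum (λ i → x i ⊗ sum (λ j → M i j ⊗ y j))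
  sum-*-assoc x M y = begin
    sum (λ j → sum (λ i → x i ⊗ M i j) ⊗ y j)
      ≈⟨ sum-cong-≋ (λ j → *-distribʳ-sum (y j) (λ i → x i ⊗ M i j)) ⟩
    sum (λ j → sum (λ i → x i ⊗ M i j ⊗ y j))
      ≈⟨ ∑-comm (λ j i → x i ⊗ M i j ⊗ y j) ⟩
    sum (λ i → sum (λ j → x i ⊗ M i j ⊗ y j))
      ≈⟨ sum-cong-≋ (λ i → sum-cong-≋ λ j → R.*-assoc (x i) (M i j) (y j)) ⟩
    sum (λ i → sum (λ j → x i ⊗ (M i j ⊗ y j)))
      ≈⟨ sum-cong-≋ (λ i → *-distribˡ-sum (x i) (λ j → M i j ⊗ y j)) ⟨
    sum (λ i → x i ⊗ sum (λ j → M i j ⊗ y j)) ∎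

  sum-*-exchange : ∀ {m n} (x : Vector Carrier m) (M : Fin m → Vector Carrier n)
    (y : Vector Carrier n) →
    sum (λ j → y j ⊗ sum (λ i → x i ⊗ M i j)) ≋ sum (λ i → x i ⊗ sum (λ j → y j ⊗ M i j))
  sum-*-exchange x M y = begin
    sum (λ j → y j ⊗ sum (λ i → x i ⊗ M i j))
      ≈⟨ sum-cong-≋ (λ j → R.*-comm (y j) _) ⟩
    sum (λ j → sum (λ i → x i ⊗ M i j) ⊗ y j)
      ≈⟨ sum-*-assoc x M y ⟩
    sum (λ i → x i ⊗ sum (λ j → M i j ⊗ y j))
      ≈⟨ sum-cong-≋ (λ i → R.*-congˡ {x i} (sum-cong-≋ λ j → R.*-comm (M i j) (y j))) ⟩
    sum (λ i → x i ⊗ sum (λ j → y j ⊗ M i j)) ∎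

  sum-single : ∀ {n} (f : Vector Carrier n) i → (∀ j → j ≢ i → f j ≋ 0#) → sum f ≋ f i
  sum-single {suc n} f i f≈0 = begin
    sum f                              ≈⟨ sum-remove f ⟩
    f i ⊕ sum (λ k → f (punchIn i k))
      ≈⟨ R.+-congˡ (sum-zero λ k → f≈0 (punchIn i k) (Fin.punchInᵢ≢i i k)) ⟩
    f i ⊕ 0#                           ≈⟨ R.+-identityʳ (f i) ⟩
    f i                                ∎

  -- The vector `w` is known only entry by entry, so that the lemma applies to computed columns of
  -- an identity matrix as well as to `e i`.
  sum-unit : ∀ {n} (x w : Vector Carrier n) i → w i ≋ 1# → (∀ j → j ≢ i → w j ≋ 0#) →
    sum (λ j → x j ⊗ w j) ≋ x i
  sum-unit x w i wᵢ≈1 w≈0 = begin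
    sum (λ j → x j ⊗ w j)   ≈⟨ sum-single _ i (λ j j≢i → R.trans (R.*-congˡ (w≈0 j j≢i)) (R.zeroʳ (x j))) ⟩
    x i ⊗ w i               ≈⟨ R.*-congˡ wᵢ≈1 ⟩
    x i ⊗ 1#                ≈⟨ R.*-identityʳ (x i) ⟩
    x i                     ∎

module ∑ℕ = SumLemmas ℕ.+-*-commutativeSemiring
module ∑ℤ = SumLemmas ℤ.+-*-commutativeSemiring
module ∑ℚ = SumLemmas (CommutativeRing.commutativeSemiring ℚ.+-*-commutativeRing)

-- The embedding of ℤ in ℚ

⟦_⟧ : ℤ → ℚ
⟦ k ⟧ = k ℚ./ 1

private
  toℚᵘ-⟦⟧ : ∀ k → ℚ.toℚᵘ ⟦ k ⟧ ℚᵘ.≃ ℚᵘ.mkℚᵘ k 0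
  toℚᵘ-⟦⟧ k = ℚ.toℚᵘ-fromℚᵘ (ℚᵘ.mkℚᵘ k 0)

⟦⟧-homo-+ : ∀ a b → ⟦ a ℤ.+ b ⟧ ≡ ⟦ a ⟧ ℚ.+ ⟦ b ⟧
⟦⟧-homo-+ a b = ℚ.toℚᵘ-injective (begin
  ℚ.toℚᵘ ⟦ a ℤ.+ b ⟧                  ≈⟨ toℚᵘ-⟦⟧ (a ℤ.+ b) ⟩
  ℚᵘ.mkℚᵘ (a ℤ.+ b) 0
    ≡⟨ cong (λ i → ℚᵘ.mkℚᵘ i 0) (cong₂ ℤ._+_ (ℤ.*-identityʳ a) (ℤ.*-identityʳ b)) ⟨
  ℚᵘ.mkℚᵘ a 0 ℚᵘ.+ ℚᵘ.mkℚᵘ b 0        ≈⟨ ℚᵘ.+-cong (toℚᵘ-⟦⟧ a) (toℚᵘ-⟦⟧ b) ⟨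
  ℚ.toℚᵘ ⟦ a ⟧ ℚᵘ.+ ℚ.toℚᵘ ⟦ b ⟧      ≈⟨ ℚ.toℚᵘ-homo-+ ⟦ a ⟧ ⟦ b ⟧ ⟨
  ℚ.toℚᵘ (⟦ a ⟧ ℚ.+ ⟦ b ⟧)            ∎)
  where open ℚᵘ.≃-Reasoning

⟦⟧-homo-* : ∀ a b → ⟦ a ℤ.* b ⟧ ≡ ⟦ a ⟧ ℚ.* ⟦ b ⟧
⟦⟧-homo-* a b = ℚ.toℚᵘ-injective (begin
  ℚ.toℚᵘ ⟦ a ℤ.* b ⟧                  ≈⟨ toℚᵘ-⟦⟧ (a ℤ.* b) ⟩
  ℚᵘ.mkℚᵘ a 0 ℚᵘ.* ℚᵘ.mkℚᵘ b 0        ≈⟨ ℚᵘ.*-cong (toℚᵘ-⟦⟧ a) (toℚᵘ-⟦⟧ b) ⟨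
  ℚ.toℚᵘ ⟦ a ⟧ ℚᵘ.* ℚ.toℚᵘ ⟦ b ⟧      ≈⟨ ℚ.toℚᵘ-homo-* ⟦ a ⟧ ⟦ b ⟧ ⟨
  ℚ.toℚᵘ (⟦ a ⟧ ℚ.* ⟦ b ⟧)            ∎)
  where open ℚᵘ.≃-Reasoning

⟦⟧-homo‿- : ∀ a → ⟦ ℤ.- a ⟧ ≡ ℚ.- ⟦ a ⟧
⟦⟧-homo‿- a = ℚ.toℚᵘ-injective (begin
  ℚ.toℚᵘ ⟦ ℤ.- a ⟧      ≈⟨ toℚᵘ-⟦⟧ (ℤ.- a) ⟩
  ℚᵘ.- ℚᵘ.mkℚᵘ a 0      ≈⟨ ℚᵘ.-‿cong (toℚᵘ-⟦⟧ a) ⟨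
  ℚᵘ.- ℚ.toℚᵘ ⟦ a ⟧     ≈⟨ ℚ.toℚᵘ-homo‿- ⟦ a ⟧ ⟨
  ℚ.toℚᵘ (ℚ.- ⟦ a ⟧)    ∎)
  where open ℚᵘ.≃-Reasoning

⟦⟧-mono-≤ : ∀ {a b} → a ℤ.≤ b → ⟦ a ⟧ ℚ.≤ ⟦ b ⟧
⟦⟧-mono-≤ {a} {b} a≤b = ℚ.toℚᵘ-cancel-≤
  (ℚᵘ.≤-respˡ-≃ (ℚᵘ.≃-sym (toℚᵘ-⟦⟧ a)) (ℚᵘ.≤-respʳ-≃ (ℚᵘ.≃-sym (toℚᵘ-⟦⟧ b))
    (ℚᵘ.*≤* (ℤ.*-monoʳ-≤-nonNeg (+ 1) a≤b))))

⟦⟧-∣∣ : ∀ a → ℚ.∣ ⟦ a ⟧ ∣ ≡ ⟦ + ℤ.∣ a ∣ ⟧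
⟦⟧-∣∣ (+ k) = ℚ.0≤p⇒∣p∣≡p (⟦⟧-mono-≤ (ℤ.+≤+ (ℕ.z≤n {k})))
⟦⟧-∣∣ -[1+ k ] = begin
  ℚ.∣ ⟦ ℤ.- (+ suc k) ⟧ ∣   ≡⟨ cong ℚ.∣_∣ (⟦⟧-homo‿- (+ suc k)) ⟩
  ℚ.∣ ℚ.- ⟦ + suc k ⟧ ∣     ≡⟨ ℚ.∣-p∣≡∣p∣ ⟦ + suc k ⟧ ⟩
  ℚ.∣ ⟦ + suc k ⟧ ∣         ≡⟨ ⟦⟧-∣∣ (+ suc k) ⟩
  ⟦ + suc k ⟧               ∎
  where open ≡-Reasoning

⟦⟧-homo-∑ : ∀ {n} (f : Vector ℤ n) → ⟦ ∑ℤ f ⟧ ≡ ∑ℚ.sum (λ i → ⟦ f i ⟧)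
⟦⟧-homo-∑ {zero} f = refl
⟦⟧-homo-∑ {suc n} f =
  trans (⟦⟧-homo-+ (f zero) _) (cong (⟦ f zero ⟧ ℚ.+_) (⟦⟧-homo-∑ (f ∘ suc)))

i≤+∣i∣ : ∀ i → i ℤ.≤ + ℤ.∣ i ∣
i≤+∣i∣ (+ k) = ℤ.≤-refl
i≤+∣i∣ -[1+ k ] = ℤ.-≤+

-- A denominator is at least 1, so dropping it from the absolute value can only increase the number.
-- This provides integer bounds for rationals.
p≤⟦∣↥p∣⟧ : ∀ p → p ℚ.≤ ⟦ + ℤ.∣ ℚ.↥ p ∣ ⟧
p≤⟦∣↥p∣⟧ p@(ℚ.mkℚ _ _ _) = ℚ.toℚᵘ-cancel-≤ (ℚᵘ.≤-respʳ-≃ (ℚᵘ.≃-sym (toℚᵘ-⟦⟧ (+ ℤ.∣ ℚ.↥ p ∣)))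
  (ℚᵘ.*≤* (begin
    ℚ.↥ p ℤ.* + 1                 ≡⟨ ℤ.*-identityʳ (ℚ.↥ p) ⟩
    ℚ.↥ p                         ≤⟨ i≤+∣i∣ (ℚ.↥ p) ⟩
    + ℤ.∣ ℚ.↥ p ∣                  ≤⟨ ℤ.+≤+ (ℕ.m≤m*n ℤ.∣ ℚ.↥ p ∣ (ℚ.↧ₙ p)) ⟩
    + (ℤ.∣ ℚ.↥ p ∣ ℕ.* ℚ.↧ₙ p)     ≡⟨ ℤ.pos-* ℤ.∣ ℚ.↥ p ∣ (ℚ.↧ₙ p) ⟩
    + ℤ.∣ ℚ.↥ p ∣ ℤ.* ℚ.↧ p        ∎)))
  where
  open ℤ.≤-Reasoning

-- Order and equality of real numbers

private
  both : ∀ {P Q : ℕ → Set} → Eventually P → Eventually Q → Eventually (λ n → P n × Q n)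
  both (M , p) (N , q) = M ℕ.⊔ N , λ n n≥ →
    p n (ℕ.m⊔n≤o⇒m≤o M N n≥) , q n (ℕ.m⊔n≤o⇒n≤o M N n≥)

  0<½ε : ∀ {ε} → 0ℚ ℚ.< ε → 0ℚ ℚ.< ½ ℚ.* ε
  0<½ε = ℚ.*-monoʳ-<-pos ½

  p≤∣p∣ : ∀ p → p ℚ.≤ ℚ.∣ p ∣
  p≤∣p∣ p with ℚ.≤-total 0ℚ p
  ... | inj₁ 0≤p = ℚ.≤-reflexive (sym (ℚ.0≤p⇒∣p∣≡p 0≤p))
  ... | inj₂ p≤0 = ℚ.≤-trans p≤0 (ℚ.0≤∣p∣ p)

  ∣p-q∣≡∣q-p∣ : ∀ p q → ℚ.∣ p ℚ.- q ∣ ≡ ℚ.∣ q ℚ.- p ∣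
  ∣p-q∣≡∣q-p∣ p q = trans (sym (ℚ.∣-p∣≡∣p∣ (p ℚ.- q))) (cong ℚ.∣_∣ (swap p q))
    where
    swap : ∀ p q → ℚ.- (p ℚ.- q) ≡ q ℚ.- p
    swap = solve 2 (λ p q → :- (p :- q) := q :- p) refl where open +-*-Solver

  ∣p-q∣<r⇒p<q+r : ∀ {p q r} → ℚ.∣ p ℚ.- q ∣ ℚ.< r → p ℚ.< q ℚ.+ r
  ∣p-q∣<r⇒p<q+r {p} {q} {r} ∣p-q∣<r = begin-strict
    p                          ≡⟨ split p q ⟩
    q ℚ.+ (p ℚ.- q)            ≤⟨ ℚ.+-monoʳ-≤ q (p≤∣p∣ _) ⟩
    q ℚ.+ ℚ.∣ p ℚ.- q ∣        <⟨ ℚ.+-monoʳ-< q ∣p-q∣<r ⟩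
    q ℚ.+ r                    ∎
    where
    open ℚ.≤-Reasoning
    split : ∀ p q → p ≡ q ℚ.+ (p ℚ.- q)
    split = solve 2 (λ p q → p := q :+ (p :- q)) refl where open +-*-Solver

  p<q+r⇒p-q<r : ∀ {p q r} → p ℚ.< q ℚ.+ r → p ℚ.- q ℚ.< r
  p<q+r⇒p-q<r {p} {q} {r} p<q+r =
    subst (p ℚ.- q ℚ.<_) (cancel q r) (ℚ.+-monoˡ-< (ℚ.- q) p<q+r)
    where
    cancel : ∀ q r → q ℚ.+ r ℚ.- q ≡ r
    cancel = solve 2 (λ q r → q :+ r :- q := r) refl where open +-*-Solver

  ∣p-q∣<r : ∀ {p q r} → p ℚ.< q ℚ.+ r → q ℚ.< p ℚ.+ r → ℚ.∣ p ℚ.- q ∣ ℚ.< r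
  ∣p-q∣<r {p} {q} {r} p<q+r q<p+r with ℚ.∣p∣≡p∨∣p∣≡-p (p ℚ.- q)
  ... | inj₁ eq = subst (ℚ._< r) (sym eq) (p<q+r⇒p-q<r p<q+r)
  ... | inj₂ eq = subst (ℚ._< r) (trans (swap p q) (sym eq)) (p<q+r⇒p-q<r q<p+r)
    where
    swap : ∀ p q → q ℚ.- p ≡ ℚ.- (p ℚ.- q)
    swap = solve 2 (λ p q → q :- p := :- (p :- q)) refl where open +-*-Solver

-- The real arguments below are explicit because Agda cannot recover the
-- Cauchy proof inside x or y from the unfolded propositions x ≈ y and x ≤ y.

termwise-≤ : ∀ x y → (∀ n → seq x n ℚ.≤ seq y n) → x ≤ y
termwise-≤ x y x≤y ε 0<ε = 0 , λ n _ → begin-strict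
  seq x n            ≤⟨ x≤y n ⟩
  seq y n            ≡⟨ ℚ.+-identityʳ (seq y n) ⟨
  seq y n ℚ.+ 0ℚ     <⟨ ℚ.+-monoʳ-< (seq y n) 0<ε ⟩
  seq y n ℚ.+ ε      ∎
  where open ℚ.≤-Reasoning

≈⇒≤ : ∀ x y → x ≈ y → x ≤ y
≈⇒≤ x y x≈y ε 0<ε = let (N , p) = x≈y ε 0<ε in N , λ n n≥ → ∣p-q∣<r⇒p<q+r (p n n≥)

≈-sym : ∀ x y → x ≈ y → y ≈ x
≈-sym x y x≈y ε 0<ε = let (N , p) = x≈y ε 0<ε in N , λ n n≥ →
  subst (ℚ._< ε) (∣p-q∣≡∣q-p∣ (seq x n) (seq y n)) (p n n≥)

≤-antisym : ∀ x y → x ≤ y → y ≤ x → x ≈ y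
≤-antisym x y x≤y y≤x ε 0<ε =
  let (N , p) = both {λ n → seq x n ℚ.< seq y n ℚ.+ ε} (x≤y ε 0<ε) (y≤x ε 0<ε)
  in N , λ n n≥ → ∣p-q∣<r (proj₁ (p n n≥)) (proj₂ (p n n≥))

termwise-≈ : ∀ x y → (∀ n → seq x n ≡ seq y n) → x ≈ y
termwise-≈ x y x≡y = ≤-antisym x y
  (termwise-≤ x y λ n → ℚ.≤-reflexive (x≡y n))
  (termwise-≤ y x λ n → ℚ.≤-reflexive (sym (x≡y n)))

≤-trans : ∀ x y z → x ≤ y → y ≤ z → x ≤ z
≤-trans x y z x≤y y≤z ε 0<ε =
  let (N , p) = both {λ n → seq x n ℚ.< seq y n ℚ.+ ½ ℚ.* ε}
                  (x≤y (½ ℚ.* ε) (0<½ε 0<ε)) (y≤z (½ ℚ.* ε) (0<½ε 0<ε))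
  in N , λ n n≥ → begin-strict
  seq x n                              <⟨ proj₁ (p n n≥) ⟩
  seq y n ℚ.+ ½ ℚ.* ε                  <⟨ ℚ.+-monoˡ-< (½ ℚ.* ε) (proj₂ (p n n≥)) ⟩
  seq z n ℚ.+ ½ ℚ.* ε ℚ.+ ½ ℚ.* ε      ≡⟨ join (seq z n) ε ⟩
  seq z n ℚ.+ ε                        ∎
  where
  open ℚ.≤-Reasoning
  join : ∀ p ε → p ℚ.+ ½ ℚ.* ε ℚ.+ ½ ℚ.* ε ≡ p ℚ.+ ε
  join = solve 2 (λ p e → p :+ con ½ :* e :+ con ½ :* e := p :+ e) refl where open +-*-Solver

≈-trans : ∀ x y z → x ≈ y → y ≈ z → x ≈ z
≈-trans x y z x≈y y≈z = ≤-antisym x z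
  (≤-trans x y z (≈⇒≤ x y x≈y) (≈⇒≤ y z y≈z))
  (≤-trans z y x (≈⇒≤ z y (≈-sym y z y≈z)) (≈⇒≤ y x (≈-sym x y x≈y)))

≤-preorder : Preorder 0ℓ 0ℓ 0ℓ
≤-preorder = record
  { Carrier    = ℝ
  ; _≈_        = _≈_
  ; _≲_        = _≤_
  ; isPreorder = record
    { isEquivalence = record
      { refl  = λ {x} → termwise-≈ x x λ _ → refl
      ; sym   = λ {x} {y} → ≈-sym x y
      ; trans = λ {x} {y} {z} → ≈-trans x y z
      }
    ; reflexive     = λ {x} {y} → ≈⇒≤ x y
    ; trans         = λ {x} {y} {z} → ≤-trans x y z
    }
  }

module ≤-Reasoning where
  open import Relation.Binary.Reasoning.Preorder ≤-preorder public

  -- All operations on reals act termwise, so an identity of `ℚ` at each index is already a step in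
  -- a chain of reals.
  step-≗ : ∀ x {y z} → y IsRelatedTo z → (∀ n → seq x n ≡ seq y n) → x IsRelatedTo z
  step-≗ x {y} y∼z x≗y = step-≈ x y∼z (termwise-≈ x y x≗y)

  infixr 2 step-≗
  syntax step-≗ x y∼z x≗y = x ≗⟨ x≗y ⟩ y∼z

module ≈-Reasoning where
  open import Relation.Binary.Reasoning.Setoid (Preorder.Eq.setoid ≤-preorder) public

  step-≗ : ∀ x {y z} → y IsRelatedTo z → (∀ n → seq x n ≡ seq y n) → x IsRelatedTo z
  step-≗ x {y} y∼z x≗y = step-≈ x y∼z (termwise-≈ x y x≗y)

  infixr 2 step-≗
  syntax step-≗ x y∼z x≗y = x ≗⟨ x≗y ⟩ y∼z

+-mono-≤ : ∀ w x y z → w ≤ x → y ≤ z → w + y ≤ x + z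
+-mono-≤ w x y z w≤x y≤z ε 0<ε =
  let (N , p) = both {λ n → seq w n ℚ.< seq x n ℚ.+ ½ ℚ.* ε}
                  (w≤x (½ ℚ.* ε) (0<½ε 0<ε)) (y≤z (½ ℚ.* ε) (0<½ε 0<ε))
  in N , λ n n≥ → subst (seq w n ℚ.+ seq y n ℚ.<_) (regroup (seq x n) (seq z n) ε)
    (ℚ.+-mono-< (proj₁ (p n n≥)) (proj₂ (p n n≥)))
  where
  regroup : ∀ a b ε → (a ℚ.+ ½ ℚ.* ε) ℚ.+ (b ℚ.+ ½ ℚ.* ε) ≡ (a ℚ.+ b) ℚ.+ ε
  regroup = solve 3 (λ a b e →
    (a :+ con ½ :* e) :+ (b :+ con ½ :* e) := (a :+ b) :+ e) refl where open +-*-Solver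

-‿antimono-≤ : ∀ x y → x ≤ y → - y ≤ - x
-‿antimono-≤ x y x≤y ε 0<ε = let (N , p) = x≤y ε 0<ε in N , λ n n≥ →
  subst₂ ℚ._<_ (left (seq x n) (seq y n)) (right (seq x n) (seq y n) ε)
    (ℚ.+-monoˡ-< (ℚ.- seq x n ℚ.- seq y n) (p n n≥))
  where
  open +-*-Solver
  left : ∀ a b → a ℚ.+ (ℚ.- a ℚ.- b) ≡ ℚ.- b
  left = solve 2 (λ a b → a :+ (:- a :- b) := :- b) refl
  right : ∀ a b ε → b ℚ.+ ε ℚ.+ (ℚ.- a ℚ.- b) ≡ ℚ.- a ℚ.+ ε
  right = solve 3 (λ a b e → b :+ e :+ (:- a :- b) := :- a :+ e) refl

∑-mono-≤ : ∀ {n} (f g : Vector ℝ n) → (∀ i → f i ≤ g i) → ∑ f ≤ ∑ g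
∑-mono-≤ {zero}  f g f≤g = termwise-≤ 0ℝ 0ℝ λ _ → ℚ.≤-refl
∑-mono-≤ {suc n} f g f≤g = +-mono-≤ (f zero) (g zero) (∑ (f ∘ suc)) (∑ (g ∘ suc))
  (f≤g zero) (∑-mono-≤ (f ∘ suc) (g ∘ suc) (f≤g ∘ suc))

∑-cong : ∀ {n} (f g : Vector ℝ n) → (∀ i → f i ≈ g i) → ∑ f ≈ ∑ g
∑-cong f g f≈g = ≤-antisym (∑ f) (∑ g)
  (∑-mono-≤ f g λ i → ≈⇒≤ (f i) (g i) (f≈g i))
  (∑-mono-≤ g f λ i → ≈⇒≤ (g i) (f i) (≈-sym (f i) (g i) (f≈g i)))

-- By induction through x(k + 1) = x + xk, multiplication by a natural number reduces to
-- monotonicity of addition.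
*-monoʳ-≤ : ∀ k x y → x ≤ y → x * fromℤ (+ k) ≤ y * fromℤ (+ k)
*-monoʳ-≤ zero x y _ = begin
  x * 0ℝ     ≗⟨ (λ n → ℚ.*-zeroʳ (seq x n)) ⟩
  0ℝ         ≗⟨ (λ n → sym (ℚ.*-zeroʳ (seq y n))) ⟩
  y * 0ℝ     ∎
  where open ≤-Reasoning
*-monoʳ-≤ (suc k) x y x≤y = begin
  x * fromℤ (+ suc k)      ≗⟨ (λ n → expand (seq x n)) ⟩
  x + x * fromℤ (+ k)
    ≲⟨ +-mono-≤ x y (x * fromℤ (+ k)) (y * fromℤ (+ k)) x≤y (*-monoʳ-≤ k x y x≤y) ⟩
  y + y * fromℤ (+ k)      ≗⟨ (λ n → sym (expand (seq y n))) ⟩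
  y * fromℤ (+ suc k)      ∎
  where
  open ≤-Reasoning
  expand : ∀ p → p ℚ.* ⟦ + suc k ⟧ ≡ p ℚ.+ p ℚ.* ⟦ + k ⟧
  expand p = trans (cong (p ℚ.*_) (⟦⟧-homo-+ (+ 1) (+ k)))
    (trans (ℚ.*-distribˡ-+ p 1ℚ ⟦ + k ⟧) (cong (ℚ._+ p ℚ.* ⟦ + k ⟧) (ℚ.*-identityʳ p)))

*-antimonoʳ-≤ : ∀ k x y → x ≤ y → y * fromℤ -[1+ k ] ≤ x * fromℤ -[1+ k ]
*-antimonoʳ-≤ k x y x≤y = begin
  y * fromℤ -[1+ k ]        ≗⟨ (λ n → negate (seq y n)) ⟩
  - (y * fromℤ (+ suc k))
    ≲⟨ -‿antimono-≤ (x * fromℤ (+ suc k)) (y * fromℤ (+ suc k)) (*-monoʳ-≤ (suc k) x y x≤y) ⟩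
  - (x * fromℤ (+ suc k))   ≗⟨ (λ n → sym (negate (seq x n))) ⟩
  x * fromℤ -[1+ k ]        ∎
  where
  open ≤-Reasoning
  negate : ∀ p → p ℚ.* ⟦ -[1+ k ] ⟧ ≡ ℚ.- (p ℚ.* ⟦ + suc k ⟧)
  negate p = trans (cong (p ℚ.*_) (⟦⟧-homo‿- (+ suc k))) (sym (ℚ.neg-distribʳ-* p ⟦ + suc k ⟧))

*-congʳ : ∀ a x y → x ≈ y → x * fromℤ a ≈ y * fromℤ a
*-congʳ (+ k) x y x≈y = ≤-antisym (x * fromℤ (+ k)) (y * fromℤ (+ k))
  (*-monoʳ-≤ k x y (≈⇒≤ x y x≈y)) (*-monoʳ-≤ k y x (≈⇒≤ y x (≈-sym x y x≈y)))
*-congʳ -[1+ k ] x y x≈y = ≤-antisym (x * fromℤ -[1+ k ]) (y * fromℤ -[1+ k ])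
  (*-antimonoʳ-≤ k y x (≈⇒≤ y x (≈-sym x y x≈y))) (*-antimonoʳ-≤ k x y (≈⇒≤ x y x≈y))

*-congˡ : ∀ a x y → x ≈ y → fromℤ a * x ≈ fromℤ a * y
*-congˡ a x y x≈y = begin
  fromℤ a * x     ≗⟨ (λ n → ℚ.*-comm ⟦ a ⟧ (seq x n)) ⟩
  x * fromℤ a     ≈⟨ *-congʳ a x y x≈y ⟩
  y * fromℤ a     ≗⟨ (λ n → ℚ.*-comm (seq y n) ⟦ a ⟧) ⟩
  fromℤ a * y     ∎
  where open ≈-Reasoning

seq-∑ : ∀ {n} (f : Vector ℝ n) k → seq (∑ f) k ≡ ∑ℚ.sum (λ i → seq (f i) k)
seq-∑ {zero} f k = refl
seq-∑ {suc n} f k = cong (seq (f zero) k ℚ.+_) (seq-∑ (f ∘ suc) k)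

fromℤ-mono-≤ : ∀ {a b} → a ℤ.≤ b → fromℤ a ≤ fromℤ b
fromℤ-mono-≤ {a} {b} a≤b = termwise-≤ (fromℤ a) (fromℤ b) λ _ → ⟦⟧-mono-≤ a≤b

-- Distinct integers are at least 1 apart: b < a gives b + 1 ≤ a, while a ≤ b in the reals, read
-- with tolerance 1, gives a < b + 1.
fromℤ-cancel-≤ : ∀ {a b} → fromℤ a ≤ fromℤ b → a ℤ.≤ b
fromℤ-cancel-≤ {a} {b} a≤b = ℤ.≮⇒≥ λ b<a →
  let (N , p) = a≤b 1ℚ (ℚ.positive⁻¹ 1ℚ) in
  ℚ.<-irrefl refl (ℚ.<-≤-trans (p N ℕ.≤-refl) (begin
    ⟦ b ⟧ ℚ.+ 1ℚ       ≡⟨ ⟦⟧-homo-+ b (+ 1) ⟨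
    ⟦ b ℤ.+ + 1 ⟧      ≡⟨ cong ⟦_⟧ (ℤ.+-comm b (+ 1)) ⟩
    ⟦ ℤ.suc b ⟧        ≤⟨ ⟦⟧-mono-≤ (ℤ.i<j⇒suc[i]≤j b<a) ⟩
    ⟦ a ⟧              ∎))
  where open ℚ.≤-Reasoning

fromℤ-injective : ∀ {a b} → fromℤ a ≈ fromℤ b → a ≡ b
fromℤ-injective {a} {b} a≈b = ℤ.≤-antisym
  (fromℤ-cancel-≤ (≈⇒≤ (fromℤ a) (fromℤ b) a≈b))
  (fromℤ-cancel-≤ (≈⇒≤ (fromℤ b) (fromℤ a) (≈-sym (fromℤ a) (fromℤ b) a≈b)))

-- Beyond the Cauchy index N for tolerance 1, all terms stay below the N-th absolute value plus 1;
-- the numerator of this rational is an integer bound.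
∣∣-bounded : ∀ x → ∃ λ C → ∣ x ∣ ≤ fromℤ (+ C)
∣∣-bounded x with cauchy ∣ x ∣ 1ℚ (ℚ.positive⁻¹ 1ℚ)
... | N , p = ℤ.∣ ℚ.↥ B ∣ , λ ε 0<ε → N , λ n n≥ → begin-strict
  ℚ.∣ seq x n ∣                     <⟨ ∣p-q∣<r⇒p<q+r (p n N n≥ ℕ.≤-refl) ⟩
  B                                 ≤⟨ p≤⟦∣↥p∣⟧ B ⟩
  ⟦ + ℤ.∣ ℚ.↥ B ∣ ⟧                 ≡⟨ ℚ.+-identityʳ _ ⟨
  ⟦ + ℤ.∣ ℚ.↥ B ∣ ⟧ ℚ.+ 0ℚ          <⟨ ℚ.+-monoʳ-< ⟦ + ℤ.∣ ℚ.↥ B ∣ ⟧ 0<ε ⟩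
  ⟦ + ℤ.∣ ℚ.↥ B ∣ ⟧ ℚ.+ ε           ∎
  where
  open ℚ.≤-Reasoning
  B : ℚ
  B = ℚ.∣ seq x N ∣ ℚ.+ 1ℚ

∑-fromℤ : ∀ {n} (f : Vector ℤ n) → ∑ (λ i → fromℤ (f i)) ≈ fromℤ (∑ℤ f)
∑-fromℤ f = termwise-≈ (∑ λ i → fromℤ (f i)) (fromℤ (∑ℤ f)) λ k →
  trans (seq-∑ (λ i → fromℤ (f i)) k) (sym (⟦⟧-homo-∑ f))

-- Integer vectors

infix 8 _∙_

_∙_ : ∀ {n} → Vector ℤ n → Vector ℤ n → ℤ
x ∙ y = ∑ℤ λ i → x i ℤ.* y i

‖_‖₁ : ∀ {n} → Vector ℤ n → ℕ
‖ x ‖₁ = ∑ℕ.sum λ i → ℤ.∣ x i ∣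

e : ∀ {n} → Fin n → Vector ℤ n
e i j = if does (i Fin.≟ j) then + 1 else + 0

e-diagonal : ∀ {n} (i : Fin n) → e i i ≡ + 1
e-diagonal i = cong (if_then + 1 else + 0) (dec-true (i Fin.≟ i) refl)

e-off-diagonal : ∀ {n} {i j : Fin n} → i ≢ j → e i j ≡ + 0
e-off-diagonal {i = i} {j} i≢j = cong (if_then + 1 else + 0) (dec-false (i Fin.≟ j) i≢j)

∙-e : ∀ {n} (x : Vector ℤ n) i → x ∙ e i ≡ x i
∙-e x i = ∑ℤ.sum-unit x (e i) i (e-diagonal i) λ j j≢i → e-off-diagonal (j≢i ∘ sym)

‖e‖₁ : ∀ {n} (i : Fin n) → ‖ e i ‖₁ ≡ 1
‖e‖₁ i = trans
  (∑ℕ.sum-single (λ j → ℤ.∣ e i j ∣) i λ j j≢i → cong ℤ.∣_∣ (e-off-diagonal (j≢i ∘ sym)))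
  (cong ℤ.∣_∣ (e-diagonal i))

∙-negˡ : ∀ {n} (x y : Vector ℤ n) → (λ i → ℤ.- x i) ∙ y ≡ ℤ.- (x ∙ y)
∙-negˡ {zero}  x y = refl
∙-negˡ {suc n} x y = begin
  (ℤ.- x zero) ℤ.* y zero ℤ.+ (λ i → ℤ.- x (suc i)) ∙ (y ∘ suc)
    ≡⟨ cong₂ ℤ._+_ (sym (ℤ.neg-distribˡ-* (x zero) (y zero))) (∙-negˡ (x ∘ suc) (y ∘ suc)) ⟩
  ℤ.- (x zero ℤ.* y zero) ℤ.- (x ∘ suc) ∙ (y ∘ suc)
    ≡⟨ ℤ.neg-distrib-+ (x zero ℤ.* y zero) ((x ∘ suc) ∙ (y ∘ suc)) ⟨
  ℤ.- (x ∙ y) ∎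
  where open ≡-Reasoning

-- Linear functionals on real combinations of lattice vectors

·-cong : ∀ {d} (z : ℤ^ d) {x y : ℝ^ d} → x ≈ᵛ y → z · x ≈ z · y
·-cong z {x} {y} x≈y = ∑-cong (λ j → ι z j * x j) (λ j → ι z j * y j) λ j →
  *-congˡ (z j) (x j) (y j) (x≈y j)

·-ι : ∀ {d} (z v : ℤ^ d) → z · ι v ≈ fromℤ (z ∙ v)
·-ι z v = begin
  z · ι v                          ≗⟨ (λ k → trans (seq-∑ (λ j → ι z j * ι v j) k)
    (trans (∑ℚ.sum-cong-≗ λ j → sym (⟦⟧-homo-* (z j) (v j))) (sym (⟦⟧-homo-∑ λ j → z j ℤ.* v j)))) ⟩
  fromℤ (z ∙ v)                    ∎
  where open ≈-Reasoning

·-lincomb : ∀ {d n} (z : ℤ^ d) (u : Vector (ℤ^ d) n) (c : Vector ℝ n) →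
  z · lincomb c (λ i → ι (u i)) ≈ ∑ λ i → c i * fromℤ (z ∙ u i)
·-lincomb z u c = termwise-≈ (z · lincomb c (λ i → ι (u i))) (∑ λ i → c i * fromℤ (z ∙ u i)) λ k → begin
  seq (z · lincomb c (λ i → ι (u i))) k
    ≡⟨ seq-∑ (λ j → ι z j * lincomb c (λ i → ι (u i)) j) k ⟩
  ∑ℚ.sum (λ j → ⟦ z j ⟧ ℚ.* seq (lincomb c (λ i → ι (u i)) j) k)
    ≡⟨ ∑ℚ.sum-cong-≗ (λ j → cong (⟦ z j ⟧ ℚ.*_) (seq-∑ (λ i → c i * ι (u i) j) k)) ⟩
  ∑ℚ.sum (λ j → ⟦ z j ⟧ ℚ.* ∑ℚ.sum (λ i → seq (c i) k ℚ.* ⟦ u i j ⟧))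
    ≡⟨ ∑ℚ.sum-*-exchange (λ i → seq (c i) k) (λ i j → ⟦ u i j ⟧) (λ j → ⟦ z j ⟧) ⟩
  ∑ℚ.sum (λ i → seq (c i) k ℚ.* ∑ℚ.sum (λ j → ⟦ z j ⟧ ℚ.* ⟦ u i j ⟧))
    ≡⟨ ∑ℚ.sum-cong-≗ (λ i → cong (seq (c i) k ℚ.*_) (∑ℚ.sum-cong-≗ λ j → ⟦⟧-homo-* (z j) (u i j))) ⟨
  ∑ℚ.sum (λ i → seq (c i) k ℚ.* ∑ℚ.sum (λ j → ⟦ z j ℤ.* u i j ⟧))
    ≡⟨ ∑ℚ.sum-cong-≗ (λ i → cong (seq (c i) k ℚ.*_) (⟦⟧-homo-∑ λ j → z j ℤ.* u i j)) ⟨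
  ∑ℚ.sum (λ i → seq (c i) k ℚ.* ⟦ z ∙ u i ⟧)
    ≡⟨ seq-∑ (λ i → c i * fromℤ (z ∙ u i)) k ⟨
  seq (∑ λ i → c i * fromℤ (z ∙ u i)) k ∎
  where open ≡-Reasoning

-- The width of a lattice zonotope along an integer direction

-- The width along `z`, as `isWidthAlong` shows. As a natural number it can be compared decidably
-- and minimised by descent.
‖_‖[_] : ∀ {d n} → ℤ^ d → Vector (ℤ^ d) n → ℕ
‖ z ‖[ u ] = ‖ (λ i → z ∙ u i) ‖₁

-- t = top a maximises t * a over 0 ≤ t ≤ 1, and t = bottom a minimises it.
top bottom : ℤ → ℤ
top (+ _)       = + 1
top -[1+ _ ]    = + 0
bottom (+ _)    = + 0
bottom -[1+ _ ] = + 1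

top-bounds : ∀ a → + 0 ℤ.≤ top a × top a ℤ.≤ + 1
top-bounds (+ _)    = ℤ.+≤+ ℕ.z≤n , ℤ.≤-refl
top-bounds -[1+ _ ] = ℤ.≤-refl , ℤ.+≤+ ℕ.z≤n

bottom-bounds : ∀ a → + 0 ℤ.≤ bottom a × bottom a ℤ.≤ + 1
bottom-bounds (+ _)    = ℤ.≤-refl , ℤ.+≤+ ℕ.z≤n
bottom-bounds -[1+ _ ] = ℤ.+≤+ ℕ.z≤n , ℤ.≤-refl

top-upper : ∀ t → 0ℝ ≤ t → t ≤ 1ℝ → ∀ a → t * fromℤ a ≤ fromℤ (top a ℤ.* a)
top-upper t 0≤t t≤1 (+ k) = begin
  t * fromℤ (+ k)                     ≲⟨ *-monoʳ-≤ k t 1ℝ t≤1 ⟩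
  1ℝ * fromℤ (+ k)                    ≗⟨ (λ _ → sym (⟦⟧-homo-* (+ 1) (+ k))) ⟩
  fromℤ (top (+ k) ℤ.* + k)           ∎
  where open ≤-Reasoning
top-upper t 0≤t t≤1 -[1+ k ] = begin
  t * fromℤ -[1+ k ]                  ≲⟨ *-antimonoʳ-≤ k 0ℝ t 0≤t ⟩
  0ℝ * fromℤ -[1+ k ]                 ≗⟨ (λ _ → sym (⟦⟧-homo-* (+ 0) -[1+ k ])) ⟩
  fromℤ (top -[1+ k ] ℤ.* -[1+ k ])   ∎
  where open ≤-Reasoning

bottom-lower : ∀ t → 0ℝ ≤ t → t ≤ 1ℝ → ∀ a → fromℤ (bottom a ℤ.* a) ≤ t * fromℤ a
bottom-lower t 0≤t t≤1 (+ k) = begin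
  fromℤ (bottom (+ k) ℤ.* + k)           ≗⟨ (λ _ → ⟦⟧-homo-* (+ 0) (+ k)) ⟩
  0ℝ * fromℤ (+ k)                       ≲⟨ *-monoʳ-≤ k 0ℝ t 0≤t ⟩
  t * fromℤ (+ k)                        ∎
  where open ≤-Reasoning
bottom-lower t 0≤t t≤1 -[1+ k ] = begin
  fromℤ (bottom -[1+ k ] ℤ.* -[1+ k ])   ≗⟨ (λ _ → ⟦⟧-homo-* (+ 1) -[1+ k ]) ⟩
  1ℝ * fromℤ -[1+ k ]                    ≲⟨ *-antimonoʳ-≤ k t 1ℝ t≤1 ⟩
  t * fromℤ -[1+ k ]                     ∎
  where open ≤-Reasoning

-- For a single `a`, the range of t * a over 0 ≤ t ≤ 1 has length equal to the absolute value of
-- `a`; these lengths add up to the norm.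
∑-top : ∀ {n} (a : Vector ℤ n) →
  ∑ℤ (λ i → top (a i) ℤ.* a i) ≡ + ‖ a ‖₁ ℤ.+ ∑ℤ (λ i → bottom (a i) ℤ.* a i)
∑-top {zero}  a = refl
∑-top {suc n} a = begin
  top (a zero) ℤ.* a zero ℤ.+ ∑ℤ (λ i → top (a (suc i)) ℤ.* a (suc i))
    ≡⟨ cong₂ ℤ._+_ (top≡∣∣+bottom (a zero)) (∑-top (a ∘ suc)) ⟩
  (+ ℤ.∣ a zero ∣ ℤ.+ bottom (a zero) ℤ.* a zero) ℤ.+ (+ ‖ a ∘ suc ‖₁ ℤ.+ rest)
    ≡⟨ interchange (+ ℤ.∣ a zero ∣) (bottom (a zero) ℤ.* a zero) (+ ‖ a ∘ suc ‖₁) rest ⟩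
  (+ ℤ.∣ a zero ∣ ℤ.+ + ‖ a ∘ suc ‖₁) ℤ.+ (bottom (a zero) ℤ.* a zero ℤ.+ rest) ∎
  where
  open ≡-Reasoning
  rest : ℤ
  rest = ∑ℤ λ i → bottom (a (suc i)) ℤ.* a (suc i)
  open import Algebra.Properties.CommutativeSemigroup ℤ.+-commutativeSemigroup using (interchange)
  top≡∣∣+bottom : ∀ a → top a ℤ.* a ≡ + ℤ.∣ a ∣ ℤ.+ bottom a ℤ.* a
  top≡∣∣+bottom (+ k) = trans (ℤ.*-identityˡ (+ k)) (sym (ℤ.+-identityʳ (+ k)))
  top≡∣∣+bottom -[1+ k ] = sym (trans (cong (ℤ._+_ (+ suc k)) (ℤ.*-identityˡ -[1+ k ])) (ℤ.+-inverseʳ (+ suc k)))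

module _ {d n} (u : Vector (ℤ^ d) n) (z : ℤ^ d) where

  private
    attained : (s : Vector ℤ n) → (∀ i → + 0 ℤ.≤ s i × s i ℤ.≤ + 1) →
      ∃ λ x → latticeZonotope u x × z · x ≈ fromℤ (∑ℤ λ i → s i ℤ.* z ∙ u i)
    attained s 0≤s≤1 =
        x
      , (t , (λ i → fromℤ-mono-≤ (proj₁ (0≤s≤1 i)) , fromℤ-mono-≤ (proj₂ (0≤s≤1 i)))
           , λ j → termwise-≈ (x j) (x j) λ _ → refl)
      , (begin
          z · x                                  ≈⟨ ·-lincomb z u t ⟩
          ∑ (λ i → t i * fromℤ (z ∙ u i))
            ≈⟨ ∑-cong (λ i → t i * fromℤ (z ∙ u i)) (λ i → fromℤ (s i ℤ.* z ∙ u i))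
                 (λ i → termwise-≈ (t i * fromℤ (z ∙ u i)) (fromℤ (s i ℤ.* z ∙ u i))
                    λ _ → sym (⟦⟧-homo-* (s i) (z ∙ u i))) ⟩
          ∑ (λ i → fromℤ (s i ℤ.* z ∙ u i))      ≈⟨ ∑-fromℤ (λ i → s i ℤ.* z ∙ u i) ⟩
          fromℤ (∑ℤ λ i → s i ℤ.* z ∙ u i)       ∎)
      where
      open ≈-Reasoning
      t : Vector ℝ n
      t i = fromℤ (s i)
      x : ℝ^ d
      x = lincomb t λ i → ι (u i)

  -- On the point with coefficients tᵢ the functional takes the value ∑ᵢ tᵢ (z·uᵢ), so each tᵢ can
  -- be optimised on its own over [0,1]. Both extremes are attained at coefficients 0 and 1.
  isWidthAlong : IsWidthAlong (latticeZonotope u) z (fromℤ (+ ‖ z ‖[ u ]))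
  isWidthAlong =
      fromℤ M , fromℤ m
    , (attained (λ i → top (a i)) (λ i → top-bounds (a i)) , λ x (t , 0≤t≤1 , x≈) → begin
        z · x                              ≈⟨ ·-cong z x≈ ⟩
        z · lincomb t (λ i → ι (u i))      ≈⟨ ·-lincomb z u t ⟩
        ∑ (λ i → t i * fromℤ (a i))
          ≲⟨ ∑-mono-≤ (λ i → t i * fromℤ (a i)) (λ i → fromℤ (top (a i) ℤ.* a i))
               (λ i → top-upper (t i) (proj₁ (0≤t≤1 i)) (proj₂ (0≤t≤1 i)) (a i)) ⟩
        ∑ (λ i → fromℤ (top (a i) ℤ.* a i)) ≈⟨ ∑-fromℤ (λ i → top (a i) ℤ.* a i) ⟩
        fromℤ M                            ∎)
    , (attained (λ i → bottom (a i)) (λ i → bottom-bounds (a i)) , λ x (t , 0≤t≤1 , x≈) → begin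
        fromℤ m                            ≈⟨ ∑-fromℤ (λ i → bottom (a i) ℤ.* a i) ⟨
        ∑ (λ i → fromℤ (bottom (a i) ℤ.* a i))
          ≲⟨ ∑-mono-≤ (λ i → fromℤ (bottom (a i) ℤ.* a i)) (λ i → t i * fromℤ (a i))
               (λ i → bottom-lower (t i) (proj₁ (0≤t≤1 i)) (proj₂ (0≤t≤1 i)) (a i)) ⟩
        ∑ (λ i → t i * fromℤ (a i))        ≈⟨ ·-lincomb z u t ⟨
        z · lincomb t (λ i → ι (u i))      ≈⟨ ·-cong z x≈ ⟨
        z · x                              ∎)
    , termwise-≈ (fromℤ (+ ‖ z ‖[ u ])) (fromℤ M - fromℤ m) λ _ → ⟦‖‖⟧≡⟦M⟧-⟦m⟧
    where
    open ≤-Reasoning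
    a : Vector ℤ n
    a i = z ∙ u i
    M m : ℤ
    M = ∑ℤ λ i → top (a i) ℤ.* a i
    m = ∑ℤ λ i → bottom (a i) ℤ.* a i
    cancel : ∀ p q → p ≡ p ℚ.+ q ℚ.- q
    cancel = solve 2 (λ p q → p := p :+ q :- q) refl where open +-*-Solver
    ⟦‖‖⟧≡⟦M⟧-⟦m⟧ : ⟦ + ‖ z ‖[ u ] ⟧ ≡ ⟦ M ⟧ ℚ.- ⟦ m ⟧
    ⟦‖‖⟧≡⟦M⟧-⟦m⟧ = trans (cancel ⟦ + ‖ z ‖[ u ] ⟧ ⟦ m ⟧)
      (cong (ℚ._- ⟦ m ⟧) (sym (trans (cong ⟦_⟧ (∑-top a)) (⟦⟧-homo-+ (+ ‖ z ‖[ u ]) m))))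

-- An attained value never exceeds another maximum of the same functional, and dually for minima.
-- This is needed because `IsLatticeWidth` ranges over every real that is a width along `z`, not
-- only over the integer computed above.
IsWidthAlong⇒≤ : ∀ {d} {C : Pred (ℝ^ d) 0ℓ} {z : ℤ^ d} w w′ →
  IsWidthAlong C z w → IsWidthAlong C z w′ → w ≤ w′
IsWidthAlong⇒≤ {z = z} w w′
  (M , m , ((x , x∈C , zx≈M) , _) , ((y , y∈C , zy≈m) , _) , w≈)
  (M′ , m′ , (_ , ≤M′) , (_ , m′≤) , w′≈) = begin
  w             ≈⟨ w≈ ⟩
  M - m         ≲⟨ +-mono-≤ M M′ (- m) (- m′) M≤M′ (-‿antimono-≤ m′ m m′≤m) ⟩
  M′ - m′       ≈⟨ w′≈ ⟨
  w′            ∎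
  where
  open ≤-Reasoning
  M≤M′ : M ≤ M′
  M≤M′ = ≤-trans M (z · x) M′ (≈⇒≤ M (z · x) (≈-sym (z · x) M zx≈M)) (≤M′ x x∈C)
  m′≤m : m′ ≤ m
  m′≤m = ≤-trans m′ (z · y) m (m′≤ y y∈C) (≈⇒≤ (z · y) m zy≈m)

-- The width bounds the direction, so the minimum width is attained

x≤∣x∣ : ∀ x → x ≤ ∣ x ∣
x≤∣x∣ x = termwise-≤ x ∣ x ∣ λ n → p≤∣p∣ (seq x n)

-∣x∣≤x : ∀ x → - ∣ x ∣ ≤ x
-∣x∣≤x x = begin
  - ∣ x ∣       ≗⟨ (λ n → cong ℚ.-_ (sym (ℚ.∣-p∣≡∣p∣ (seq x n)))) ⟩
  - ∣ - x ∣     ≲⟨ -‿antimono-≤ (- x) ∣ - x ∣ (x≤∣x∣ (- x)) ⟩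
  - - x         ≗⟨ (λ n → neg-involutive (seq x n)) ⟩
  x             ∎
  where
  open ≤-Reasoning
  neg-involutive : ∀ p → ℚ.- ℚ.- p ≡ p
  neg-involutive = solve 1 (λ p → :- :- p := p) refl where open +-*-Solver

*-fromℤ-upper : ∀ x C → ∣ x ∣ ≤ fromℤ (+ C) → ∀ a → x * fromℤ a ≤ fromℤ (+ (C ℕ.* ℤ.∣ a ∣))
*-fromℤ-upper x C ∣x∣≤C (+ k) = begin
  x * fromℤ (+ k)              ≲⟨ *-monoʳ-≤ k x ∣ x ∣ (x≤∣x∣ x) ⟩
  ∣ x ∣ * fromℤ (+ k)          ≲⟨ *-monoʳ-≤ k ∣ x ∣ (fromℤ (+ C)) ∣x∣≤C ⟩
  fromℤ (+ C) * fromℤ (+ k)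
    ≗⟨ (λ _ → sym (trans (cong ⟦_⟧ (ℤ.pos-* C k)) (⟦⟧-homo-* (+ C) (+ k)))) ⟩
  fromℤ (+ (C ℕ.* k))          ∎
  where open ≤-Reasoning
*-fromℤ-upper x C ∣x∣≤C -[1+ k ] = begin
  x * fromℤ -[1+ k ]               ≲⟨ *-antimonoʳ-≤ k (- ∣ x ∣) x (-∣x∣≤x x) ⟩
  (- ∣ x ∣) * fromℤ -[1+ k ]
    ≲⟨ *-antimonoʳ-≤ k (- fromℤ (+ C)) (- ∣ x ∣) (-‿antimono-≤ ∣ x ∣ (fromℤ (+ C)) ∣x∣≤C) ⟩
  (- fromℤ (+ C)) * fromℤ -[1+ k ]
    ≗⟨ (λ _ → trans (cong ((ℚ.- ⟦ + C ⟧) ℚ.*_) (⟦⟧-homo‿- (+ suc k))) (neg-*-neg ⟦ + C ⟧ ⟦ + suc k ⟧)) ⟩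
  fromℤ (+ C) * fromℤ (+ suc k)
    ≗⟨ (λ _ → sym (trans (cong ⟦_⟧ (ℤ.pos-* C (suc k))) (⟦⟧-homo-* (+ C) (+ suc k)))) ⟩
  fromℤ (+ (C ℕ.* suc k))          ∎
  where
  open ≤-Reasoning
  neg-*-neg : ∀ p q → (ℚ.- p) ℚ.* (ℚ.- q) ≡ p ℚ.* q
  neg-*-neg = solve 2 (λ p q → :- p :* :- q := p :* q) refl where open +-*-Solver

upper-bound : ∀ {n} (f : Vector ℕ n) → ∃ λ B → ∀ i → f i ℕ.≤ B
upper-bound {zero}  f = 0 , λ ()
upper-bound {suc n} f with upper-bound (f ∘ suc)
... | B , f≤B = f zero ℕ.⊔ B , λ
  { zero    → ℕ.m≤m⊔n (f zero) B
  ; (suc i) → ℕ.≤-trans (f≤B i) (ℕ.m≤n⊔m (f zero) B)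
  }

∑-pos : ∀ {n} (f : Vector ℕ n) → ∑ℤ (λ i → + f i) ≡ + ∑ℕ.sum f
∑-pos {zero}  f = refl
∑-pos {suc n} f = cong (ℤ._+_ (+ f zero)) (∑-pos (f ∘ suc))

≤∧-≤⇒∣∣≤ : ∀ {i m} → i ℤ.≤ + m → ℤ.- i ℤ.≤ + m → ℤ.∣ i ∣ ℕ.≤ m
≤∧-≤⇒∣∣≤ {+ k}      (ℤ.+≤+ k≤m) _ = k≤m
≤∧-≤⇒∣∣≤ { -[1+ k ]} _ (ℤ.+≤+ k<m) = k<m

‖-‖[] : ∀ {d n} (z : ℤ^ d) (u : Vector (ℤ^ d) n) → ‖ (λ j → ℤ.- z j) ‖[ u ] ≡ ‖ z ‖[ u ]
‖-‖[] z u = ∑ℕ.sum-cong-≗ λ i →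
  trans (cong ℤ.∣_∣ (∙-negˡ z (u i))) (ℤ.∣-i∣≡∣i∣ (z ∙ u i))

‖‖[]-cong : ∀ {d n} (u : Vector (ℤ^ d) n) {y z : ℤ^ d} → y ≗ z → ‖ y ‖[ u ] ≡ ‖ z ‖[ u ]
‖‖[]-cong u y≗z = ∑ℕ.sum-cong-≗ λ i → cong ℤ.∣_∣ (∑ℤ.sum-cong-≗ λ j → cong (ℤ._* u i j) (y≗z j))

module _ {d n} (u : Vector (ℤ^ d) n) (spans : Spansℝ λ i → ι (u i)) where

  private
    -- If ∑ᵢ cᵢ uᵢ is the j-th unit vector, then zⱼ = ∑ᵢ cᵢ (z·uᵢ), which is at most the width along
    -- `z` times an integer bound for all the absolute values of the cᵢ.
    coordinate-upper : ∀ j → ∃ λ C → ∀ z → z j ℤ.≤ + (C ℕ.* ‖ z ‖[ u ])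
    coordinate-upper j = C , λ z → fromℤ-cancel-≤ (begin
      fromℤ (z j)                               ≡⟨ cong fromℤ (∙-e z j) ⟨
      fromℤ (z ∙ e j)                           ≈⟨ ·-ι z (e j) ⟨
      z · ι (e j)                               ≈⟨ ·-cong z (proj₂ (spans (ι (e j)))) ⟨
      z · lincomb c (λ i → ι (u i))             ≈⟨ ·-lincomb z u c ⟩
      ∑ (λ i → c i * fromℤ (z ∙ u i))
        ≲⟨ ∑-mono-≤ (λ i → c i * fromℤ (z ∙ u i)) (λ i → fromℤ (+ (C ℕ.* ℤ.∣ z ∙ u i ∣)))
             (λ i → *-fromℤ-upper (c i) C (c≤C i) (z ∙ u i)) ⟩
      ∑ (λ i → fromℤ (+ (C ℕ.* ℤ.∣ z ∙ u i ∣))) ≈⟨ ∑-fromℤ (λ i → + (C ℕ.* ℤ.∣ z ∙ u i ∣)) ⟩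
      fromℤ (∑ℤ λ i → + (C ℕ.* ℤ.∣ z ∙ u i ∣))  ≡⟨ cong fromℤ (∑-pos λ i → C ℕ.* ℤ.∣ z ∙ u i ∣) ⟩
      fromℤ (+ ∑ℕ.sum λ i → C ℕ.* ℤ.∣ z ∙ u i ∣)
        ≡⟨ cong (fromℤ ∘ +_) (∑ℕ.*-distribˡ-sum C λ i → ℤ.∣ z ∙ u i ∣) ⟨
      fromℤ (+ (C ℕ.* ‖ z ‖[ u ]))              ∎)
      where
      open ≤-Reasoning
      c : Vector ℝ n
      c = proj₁ (spans (ι (e j)))
      Cᵢ : Vector ℕ n
      Cᵢ i = proj₁ (∣∣-bounded (c i))
      C : ℕ
      C = proj₁ (upper-bound Cᵢ)
      c≤C : ∀ i → ∣ c i ∣ ≤ fromℤ (+ C)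
      c≤C i = ≤-trans ∣ c i ∣ (fromℤ (+ Cᵢ i)) (fromℤ (+ C))
        (proj₂ (∣∣-bounded (c i))) (fromℤ-mono-≤ (ℤ.+≤+ (proj₂ (upper-bound Cᵢ) i)))

  coordinate-bound : ∃ λ C → ∀ z j → ℤ.∣ z j ∣ ℕ.≤ C ℕ.* ‖ z ‖[ u ]
  coordinate-bound = C , λ z j → ℕ.≤-trans
    -- The lower bound on the coordinate is the upper bound for the opposite direction, which has
    -- the same width.
    (≤∧-≤⇒∣∣≤ (upper j z) (subst (λ w → ℤ.- z j ℤ.≤ + (Cⱼ j ℕ.* w)) (‖-‖[] z u) (upper j (λ k → ℤ.- z k))))
    (ℕ.*-monoˡ-≤ ‖ z ‖[ u ] (proj₂ (upper-bound Cⱼ) j))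
    where
    Cⱼ : Vector ℕ d
    Cⱼ j = proj₁ (coordinate-upper j)
    C : ℕ
    C = proj₁ (upper-bound Cⱼ)
    upper : ∀ j z → z j ℤ.≤ + (Cⱼ j ℕ.* ‖ z ‖[ u ])
    upper j = proj₂ (coordinate-upper j)

anyBounded? : ∀ B {P : ℤ → Set} → (∀ i → Dec (P i)) → Dec (∃ λ i → ℤ.∣ i ∣ ℕ.≤ B × P i)
anyBounded? B {P} P? = map′ to from (ℕ.anyUpTo? (λ m → P? (+ m) ⊎-dec P? (ℤ.- + m)) (suc B))
  where
  to : (∃ λ m → m ℕ.< suc B × (P (+ m) ⊎ P (ℤ.- + m))) → ∃ λ i → ℤ.∣ i ∣ ℕ.≤ B × P i
  to (m , ℕ.s≤s m≤B , inj₁ p) = + m , m≤B , p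
  to (m , ℕ.s≤s m≤B , inj₂ p) = ℤ.- + m , subst (ℕ._≤ B) (sym (ℤ.∣-i∣≡∣i∣ (+ m))) m≤B , p
  from : (∃ λ i → ℤ.∣ i ∣ ℕ.≤ B × P i) → ∃ λ m → m ℕ.< suc B × (P (+ m) ⊎ P (ℤ.- + m))
  from (+ m , m≤B , p) = m , ℕ.s≤s m≤B , inj₁ p
  from (-[1+ m ] , m<B , p) = suc m , ℕ.s≤s m<B , inj₂ p

-- Vectors are functions, and one rebuilt from its head and tail agrees with the original only
-- pointwise; hence `P` has to respect pointwise equality.
anyInBox? : ∀ d B {P : ℤ^ d → Set} → (∀ {y z} → y ≗ z → P y → P z) → (∀ z → Dec (P z)) →
  Dec (∃ λ z → (∀ j → ℤ.∣ z j ∣ ℕ.≤ B) × P z)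
anyInBox? zero B {P} resp P? = map′
  (λ p → [] , (λ ()) , p) (λ (z , _ , p) → resp (λ ()) p) (P? [])
anyInBox? (suc d) B {P} resp P? = map′
  (λ (i , i≤B , z , z≤B , p) → i ∷ z , (λ { zero → i≤B ; (suc j) → z≤B j }) , p)
  (λ (z , z≤B , p) → z zero , z≤B zero , z ∘ suc , z≤B ∘ suc , resp (λ { zero → refl ; (suc j) → refl }) p)
  (anyBounded? B λ i → anyInBox? d B
    (λ y≗z → resp λ { zero → refl ; (suc j) → y≗z j }) λ z → P? (i ∷ z))

nonzero? : ∀ {d} (z : ℤ^ d) → Dec (Nonzero z)
nonzero? z = ¬? (Fin.all? λ j → z j ℤ.≟ + 0)

e-nonzero : ∀ {d} (i : Fin d) → Nonzero (e i)
e-nonzero i e≡0 = contradiction (trans (sym (e-diagonal i)) (e≡0 i)) λ ()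

-- Every direction of smaller width than `z` lies in a box whose size depends on the width of `z`
-- alone. Searching this box either yields a better direction or proves `z` minimal, and widths,
-- being natural numbers, cannot decrease forever.
minimal-direction : ∀ {d n} (u : Vector (ℤ^ d) n) → Spansℝ (λ i → ι (u i)) →
  (z : ℤ^ d) → Nonzero z →
  ∃ λ m → Nonzero m × ∀ y → Nonzero y → ‖ m ‖[ u ] ℕ.≤ ‖ y ‖[ u ]
minimal-direction {d} u spans z z≢0 = descend z z≢0 (<-wellFounded ‖ z ‖[ u ])
  where
  C : ℕ
  C = proj₁ (coordinate-bound u spans)

  Shorter : ℤ^ d → ℤ^ d → Set
  Shorter z y = Nonzero y × ‖ y ‖[ u ] ℕ.< ‖ z ‖[ u ]

  shorter-resp : ∀ z {x y} → x ≗ y → Shorter z x → Shorter z y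
  shorter-resp z x≗y (x≢0 , x<z) =
    (λ y≡0 → x≢0 λ j → trans (x≗y j) (y≡0 j)) , subst (ℕ._< ‖ z ‖[ u ]) (‖‖[]-cong u x≗y) x<z

  descend : ∀ z → Nonzero z → Acc ℕ._<_ ‖ z ‖[ u ] →
    ∃ λ m → Nonzero m × ∀ y → Nonzero y → ‖ m ‖[ u ] ℕ.≤ ‖ y ‖[ u ]
  descend z z≢0 (acc rec) with anyInBox? d (C ℕ.* ‖ z ‖[ u ]) (shorter-resp z)
    (λ y → nonzero? y ×-dec (‖ y ‖[ u ] ℕ.<? ‖ z ‖[ u ]))
  ... | yes (y , _ , y≢0 , y<z) = descend y y≢0 (rec y<z)
  ... | no  none = z , z≢0 , λ y y≢0 → ℕ.≮⇒≥ λ y<z → none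
    ( y
    , (λ j → ℕ.≤-trans (proj₂ (coordinate-bound u spans) y j) (ℕ.*-monoʳ-≤ C (ℕ.<⇒≤ y<z)))
    , y≢0 , y<z )

-- Integer vectors orthogonal to the coefficients of a cosimple relation

sum≡0⇒≡0 : ∀ {n} (f : Vector ℕ n) → ∑ℕ.sum f ≡ 0 → ∀ i → f i ≡ 0
sum≡0⇒≡0 f ∑f≡0 zero    = ℕ.m+n≡0⇒m≡0 (f zero) ∑f≡0
sum≡0⇒≡0 f ∑f≡0 (suc i) = sum≡0⇒≡0 (f ∘ suc) (ℕ.m+n≡0⇒n≡0 (f zero) ∑f≡0) i

-- With a nonzero entry at `i`, norm at most 2 leaves room for no other entry, or for exactly one,
-- and then both are ±1. The supports are expressed through sums against arbitrary rational `q`,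
-- ready for use at each index of the real coefficient sequences.
short-support : ∀ {n} (a : Vector ℤ n) i → a i ≢ + 0 → ‖ a ‖₁ ℕ.≤ 2 →
    (∀ (q : Vector ℚ n) → ∑ℚ.sum (λ k → q k ℚ.* ⟦ a k ⟧) ≡ q i ℚ.* ⟦ a i ⟧)
  ⊎ (∃ λ j → i ≢ j × ℤ.∣ a i ∣ ≡ 1 × ℤ.∣ a j ∣ ≡ 1 ×
      ∀ (q : Vector ℚ n) → ∑ℚ.sum (λ k → q k ℚ.* ⟦ a k ⟧) ≡ q i ℚ.* ⟦ a i ⟧ ℚ.+ q j ℚ.* ⟦ a j ⟧)
short-support {suc n} a i aᵢ≢0 ‖a‖≤2 with Fin.all? (λ k → a (punchIn i k) ℤ.≟ + 0)
... | yes rest≡0 = inj₁ λ q → trans (∑ℚ.sum-remove {i = i} (λ k → q k ℚ.* ⟦ a k ⟧))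
  (trans (cong (q i ℚ.* ⟦ a i ⟧ ℚ.+_) (∑ℚ.sum-zero λ k →
      trans (cong (λ b → q (punchIn i k) ℚ.* ⟦ b ⟧) (rest≡0 k)) (ℚ.*-zeroʳ (q (punchIn i k)))))
    (ℚ.+-identityʳ (q i ℚ.* ⟦ a i ⟧)))
-- With a single coordinate there is no other entry that could be nonzero.
short-support {suc zero} a i aᵢ≢0 ‖a‖≤2 | no rest≢0 = contradiction (λ ()) rest≢0
short-support {suc (suc n)} a i aᵢ≢0 ‖a‖≤2 | no rest≢0 =
  inj₂ (j , (λ i≡j → Fin.punchInᵢ≢i i k (sym i≡j)) , ∣aᵢ∣≡1 , ∣aⱼ∣≡1 , two-terms)
  where
  k : Fin (suc n)
  k = proj₁ (Fin.¬∀⟶∃¬ (suc n) _ (λ k → a (punchIn i k) ℤ.≟ + 0) rest≢0)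
  j : Fin (suc (suc n))
  j = punchIn i k
  rest : Vector ℤ n
  rest l = a (punchIn i (punchIn k l))
  ∣∣≥1 : ∀ {b} → b ≢ + 0 → 1 ℕ.≤ ℤ.∣ b ∣
  ∣∣≥1 b≢0 = ℕ.n≢0⇒n>0 (b≢0 ∘ ℤ.∣i∣≡0⇒i≡0)
  1≤∣aᵢ∣ : 1 ℕ.≤ ℤ.∣ a i ∣
  1≤∣aᵢ∣ = ∣∣≥1 aᵢ≢0
  1≤∣aⱼ∣ : 1 ℕ.≤ ℤ.∣ a j ∣
  1≤∣aⱼ∣ = ∣∣≥1 (proj₂ (Fin.¬∀⟶∃¬ (suc n) _ (λ k → a (punchIn i k) ℤ.≟ + 0) rest≢0))
  total : ∀ {x y z} → 1 ℕ.≤ x → 1 ℕ.≤ y → x ℕ.+ (y ℕ.+ z) ℕ.≤ 2 → x ≡ 1 × y ≡ 1 × z ≡ 0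
  total {suc zero} {suc zero} {zero} _ _ _ = refl , refl , refl
  total {suc zero} {suc zero} {suc z} _ _ (ℕ.s≤s (ℕ.s≤s ()))
  total {suc zero} {suc (suc y)} _ _ (ℕ.s≤s (ℕ.s≤s ()))
  total {suc (suc x)} {suc y} _ _ (ℕ.s≤s (ℕ.s≤s le)) = contradiction (subst (ℕ._≤ 0) (ℕ.+-suc x _) le) λ ()
  totals : ℤ.∣ a i ∣ ≡ 1 × ℤ.∣ a j ∣ ≡ 1 × ‖ rest ‖₁ ≡ 0
  totals = total 1≤∣aᵢ∣ 1≤∣aⱼ∣ (subst (ℕ._≤ 2)
    (trans (∑ℕ.sum-remove {i = i} (λ l → ℤ.∣ a l ∣))
      (cong (ℤ.∣ a i ∣ ℕ.+_) (∑ℕ.sum-remove {i = k} (λ l → ℤ.∣ a (punchIn i l) ∣)))) ‖a‖≤2)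
  ∣aᵢ∣≡1 : ℤ.∣ a i ∣ ≡ 1
  ∣aᵢ∣≡1 = proj₁ totals
  ∣aⱼ∣≡1 : ℤ.∣ a j ∣ ≡ 1
  ∣aⱼ∣≡1 = proj₁ (proj₂ totals)
  rest≡0 : ∀ l → rest l ≡ + 0
  rest≡0 l = ℤ.∣i∣≡0⇒i≡0 (sum≡0⇒≡0 (λ l → ℤ.∣ rest l ∣) (proj₂ (proj₂ totals)) l)
  two-terms : ∀ (q : Vector ℚ (suc (suc n))) → ∑ℚ.sum (λ l → q l ℚ.* ⟦ a l ⟧) ≡ q i ℚ.* ⟦ a i ⟧ ℚ.+ q j ℚ.* ⟦ a j ⟧
  two-terms q = begin
    ∑ℚ.sum (λ l → q l ℚ.* ⟦ a l ⟧)
      ≡⟨ ∑ℚ.sum-remove {i = i} (λ l → q l ℚ.* ⟦ a l ⟧) ⟩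
    q i ℚ.* ⟦ a i ⟧ ℚ.+ ∑ℚ.sum (λ l → q (punchIn i l) ℚ.* ⟦ a (punchIn i l) ⟧)
      ≡⟨ cong (q i ℚ.* ⟦ a i ⟧ ℚ.+_) (∑ℚ.sum-remove {i = k} (λ l → q (punchIn i l) ℚ.* ⟦ a (punchIn i l) ⟧)) ⟩
    q i ℚ.* ⟦ a i ⟧ ℚ.+ (q j ℚ.* ⟦ a j ⟧ ℚ.+ ∑ℚ.sum (λ l → q (punchIn i (punchIn k l)) ℚ.* ⟦ rest l ⟧))
      ≡⟨ cong (λ s → q i ℚ.* ⟦ a i ⟧ ℚ.+ (q j ℚ.* ⟦ a j ⟧ ℚ.+ s)) (∑ℚ.sum-zero λ l →
           trans (cong (λ b → q (punchIn i (punchIn k l)) ℚ.* ⟦ b ⟧) (rest≡0 l)) (ℚ.*-zeroʳ (q (punchIn i (punchIn k l))))) ⟩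
    q i ℚ.* ⟦ a i ⟧ ℚ.+ (q j ℚ.* ⟦ a j ⟧ ℚ.+ 0ℚ)
      ≡⟨ cong (q i ℚ.* ⟦ a i ⟧ ℚ.+_) (ℚ.+-identityʳ (q j ℚ.* ⟦ a j ⟧)) ⟩
    q i ℚ.* ⟦ a i ⟧ ℚ.+ q j ℚ.* ⟦ a j ⟧ ∎
    where open ≡-Reasoning

private
  ∣p∣≤∣p*⟦a⟧∣ : ∀ p {a} → a ≢ + 0 → ℚ.∣ p ∣ ℚ.≤ ℚ.∣ p ℚ.* ⟦ a ⟧ ∣
  ∣p∣≤∣p*⟦a⟧∣ p {a} a≢0 = begin
    ℚ.∣ p ∣                          ≡⟨ ℚ.*-identityʳ ℚ.∣ p ∣ ⟨
    ℚ.∣ p ∣ ℚ.* 1ℚ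
      ≤⟨ ℚ.*-monoˡ-≤-nonNeg ℚ.∣ p ∣ {{ℚ.∣-∣-nonNeg p}} (⟦⟧-mono-≤ (ℤ.+≤+ (ℕ.n≢0⇒n>0 (a≢0 ∘ ℤ.∣i∣≡0⇒i≡0)))) ⟩
    ℚ.∣ p ∣ ℚ.* ⟦ + ℤ.∣ a ∣ ⟧        ≡⟨ cong (ℚ.∣ p ∣ ℚ.*_) (⟦⟧-∣∣ a) ⟨
    ℚ.∣ p ∣ ℚ.* ℚ.∣ ⟦ a ⟧ ∣          ≡⟨ ℚ.∣p*q∣≡∣p∣*∣q∣ p ⟦ a ⟧ ⟨
    ℚ.∣ p ℚ.* ⟦ a ⟧ ∣                ∎
    where open ℚ.≤-Reasoning

  ∣p*⟦unit⟧∣ : ∀ p {a} → ℤ.∣ a ∣ ≡ 1 → ℚ.∣ p ℚ.* ⟦ a ⟧ ∣ ≡ ℚ.∣ p ∣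
  ∣p*⟦unit⟧∣ p {a} ∣a∣≡1 = begin
    ℚ.∣ p ℚ.* ⟦ a ⟧ ∣                ≡⟨ ℚ.∣p*q∣≡∣p∣*∣q∣ p ⟦ a ⟧ ⟩
    ℚ.∣ p ∣ ℚ.* ℚ.∣ ⟦ a ⟧ ∣          ≡⟨ cong (ℚ.∣ p ∣ ℚ.*_) (trans (⟦⟧-∣∣ a) (cong (⟦_⟧ ∘ +_) ∣a∣≡1)) ⟩
    ℚ.∣ p ∣ ℚ.* 1ℚ                   ≡⟨ ℚ.*-identityʳ ℚ.∣ p ∣ ⟩
    ℚ.∣ p ∣                          ∎
    where open ≡-Reasoning

  ∣p+q∣<r⇒∣p∣<∣q∣+r : ∀ p q {r} → ℚ.∣ p ℚ.+ q ∣ ℚ.< r → ℚ.∣ p ∣ ℚ.< ℚ.∣ q ∣ ℚ.+ r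
  ∣p+q∣<r⇒∣p∣<∣q∣+r p q {r} ∣p+q∣<r = begin-strict
    ℚ.∣ p ∣                          ≡⟨ cong ℚ.∣_∣ (cancel p q) ⟩
    ℚ.∣ ℚ.- q ℚ.+ (p ℚ.+ q) ∣        ≤⟨ ℚ.∣p+q∣≤∣p∣+∣q∣ (ℚ.- q) (p ℚ.+ q) ⟩
    ℚ.∣ ℚ.- q ∣ ℚ.+ ℚ.∣ p ℚ.+ q ∣    ≡⟨ cong (ℚ._+ ℚ.∣ p ℚ.+ q ∣) (ℚ.∣-p∣≡∣p∣ q) ⟩
    ℚ.∣ q ∣ ℚ.+ ℚ.∣ p ℚ.+ q ∣        <⟨ ℚ.+-monoʳ-< ℚ.∣ q ∣ ∣p+q∣<r ⟩
    ℚ.∣ q ∣ ℚ.+ r                    ∎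
    where
    open ℚ.≤-Reasoning
    cancel : ∀ p q → p ≡ ℚ.- q ℚ.+ (p ℚ.+ q)
    cancel = solve 2 (λ p q → p := :- q :+ (p :+ q)) refl where open +-*-Solver

-- A shorter `a` would have one or two nonzero entries. One entry forces cᵢ to tend to 0, because a
-- nonzero integer factor cannot shrink it; two entries ±1 force the absolute values of cᵢ and cⱼ to
-- agree in the limit. The case distinction is on integers only, so no real number has to be
-- compared with 0.
orthogonal⇒‖‖≥3 : ∀ {n} (c : Vector ℝ n) → (∀ i → ¬ c i ≈ 0ℝ) →
  (∀ i j → i ≢ j → ¬ ∣ c i ∣ ≈ ∣ c j ∣) →
  (a : Vector ℤ n) → Nonzero a → ∑ (λ i → c i * fromℤ (a i)) ≈ 0ℝ → 3 ℕ.≤ ‖ a ‖₁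
orthogonal⇒‖‖≥3 {n} c nonzero distinct a a≢0 ∑≈0 = ℕ.≰⇒> λ ‖a‖≤2 → impossible (short-support a i aᵢ≢0 ‖a‖≤2)
  where
  i : Fin n
  i = proj₁ (Fin.¬∀⟶∃¬ n _ (λ i → a i ℤ.≟ + 0) a≢0)
  aᵢ≢0 : a i ≢ + 0
  aᵢ≢0 = proj₂ (Fin.¬∀⟶∃¬ n _ (λ i → a i ℤ.≟ + 0) a≢0)

  small : ∀ {f : ℕ → ℚ} →
    (∀ k → ∑ℚ.sum (λ l → seq (c l) k ℚ.* ⟦ a l ⟧) ≡ f k) →
    ∀ ε → 0ℚ ℚ.< ε → Eventually λ k → ℚ.∣ f k ∣ ℚ.< ε
  small {f} ∑≡f ε 0<ε = let (N , p) = ∑≈0 ε 0<ε in N , λ k k≥ →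
    subst (λ s → ℚ.∣ s ∣ ℚ.< ε)
      (trans (ℚ.+-identityʳ _) (trans (seq-∑ (λ l → c l * fromℤ (a l)) k) (∑≡f k))) (p k k≥)

  impossible : ¬ _
  impossible (inj₁ one-term) = nonzero i λ ε 0<ε →
    let (N , p) = small {λ k → seq (c i) k ℚ.* ⟦ a i ⟧} (λ k → one-term λ l → seq (c l) k) ε 0<ε
    in N , λ k k≥ → subst (λ q → ℚ.∣ q ∣ ℚ.< ε) (sym (ℚ.+-identityʳ (seq (c i) k)))
      (ℚ.≤-<-trans (∣p∣≤∣p*⟦a⟧∣ (seq (c i) k) aᵢ≢0) (p k k≥))
  impossible (inj₂ (j , i≢j , ∣aᵢ∣≡1 , ∣aⱼ∣≡1 , two-terms)) = distinct i j i≢j λ ε 0<ε →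
    let P = λ k → seq (c i) k ℚ.* ⟦ a i ⟧
        Q = λ k → seq (c j) k ℚ.* ⟦ a j ⟧
        (N , p) = small {λ k → P k ℚ.+ Q k} (λ k → two-terms λ l → seq (c l) k) ε 0<ε
    in N , λ k k≥ → subst₂ (λ p q → ℚ.∣ p ℚ.- q ∣ ℚ.< ε)
      (∣p*⟦unit⟧∣ (seq (c i) k) {a i} ∣aᵢ∣≡1) (∣p*⟦unit⟧∣ (seq (c j) k) {a j} ∣aⱼ∣≡1)
      (∣p-q∣<r (∣p+q∣<r⇒∣p∣<∣q∣+r (P k) (Q k) (p k k≥))
        (∣p+q∣<r⇒∣p∣<∣q∣+r (Q k) (P k) (subst (λ s → ℚ.∣ s ∣ ℚ.< ε) (ℚ.+-comm (P k) (Q k)) (p k k≥))))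

cosimple⇒width≥3 : ∀ {d n} .{{_ : NonZero d}} (u : Vector (ℤ^ d) n) → Cosimple u →
  LatticeWidth≥ (latticeZonotope u) 3ℝ
cosimple⇒width≥3 {d} {n} u cosimple =
    fromℤ (+ ‖ m ‖[ u ])
  , ((m , m≢0 , isWidthAlong u m) , λ z z≢0 w isWidth → begin
      fromℤ (+ ‖ m ‖[ u ])     ≲⟨ fromℤ-mono-≤ (ℤ.+≤+ (m-minimal z z≢0)) ⟩
      fromℤ (+ ‖ z ‖[ u ])
        ≲⟨ IsWidthAlong⇒≤ {C = latticeZonotope u} {z} (fromℤ (+ ‖ z ‖[ u ])) w (isWidthAlong u z) isWidth ⟩
      w                        ∎)
  , fromℤ-mono-≤ (ℤ.+≤+ (orthogonal⇒‖‖≥3 coeff nonzero distinct (λ i → m ∙ u i) m∙u≢0 ∑≈0))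
  where
  open Cosimple cosimple
  open ≤-Reasoning
  -- Since d is positive, a unit vector is available as the first direction of the descent.
  i₀ : Fin d
  i₀ = fromℕ< (ℕ.n≢0⇒n>0 (ℕ.≢-nonZero⁻¹ d))
  minimal : ∃ λ m → Nonzero m × ∀ y → Nonzero y → ‖ m ‖[ u ] ℕ.≤ ‖ y ‖[ u ]
  minimal = minimal-direction u spans (e i₀) (e-nonzero i₀)
  m : ℤ^ d
  m = proj₁ minimal
  m≢0 : Nonzero m
  m≢0 = proj₁ (proj₂ minimal)
  m-minimal : ∀ y → Nonzero y → ‖ m ‖[ u ] ℕ.≤ ‖ y ‖[ u ]
  m-minimal = proj₂ (proj₂ minimal)
  -- Otherwise the width along `m` would be 0, and `coordinate-bound` would make every coordinate of
  -- `m` vanish.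
  m∙u≢0 : Nonzero λ i → m ∙ u i
  m∙u≢0 m∙u≡0 = m≢0 λ j → ℤ.∣i∣≡0⇒i≡0 (ℕ.n≤0⇒n≡0 (subst (ℤ.∣ m j ∣ ℕ.≤_)
    (trans (cong (C ℕ.*_) (∑ℕ.sum-zero λ i → cong ℤ.∣_∣ (m∙u≡0 i))) (ℕ.*-zeroʳ C))
    (proj₂ (coordinate-bound u spans) m j)))
    where
    C : ℕ
    C = proj₁ (coordinate-bound u spans)
  -- Applying the functional `m` to the cosimple relation makes the products m·uᵢ orthogonal to its
  -- coefficients.
  ∑≈0 : ∑ (λ i → coeff i * fromℤ (m ∙ u i)) ≈ 0ℝ
  ∑≈0 = ≈-trans (∑ λ i → coeff i * fromℤ (m ∙ u i)) (m · 0ᵛ) 0ℝ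
    (≈-trans (∑ λ i → coeff i * fromℤ (m ∙ u i)) (m · lincomb coeff (λ i → ι (u i))) (m · 0ᵛ)
      (≈-sym (m · lincomb coeff (λ i → ι (u i))) (∑ λ i → coeff i * fromℤ (m ∙ u i)) (·-lincomb m u coeff))
      (·-cong m relation))
    (subst (λ k → m · 0ᵛ ≈ fromℤ k) (∑ℤ.sum-zero λ j → ℤ.*-zeroʳ (m j)) (·-ι m λ _ → + 0))

-- A generic integer relation among generators of the lattice

∙-comm : ∀ {n} (x y : Vector ℤ n) → x ∙ y ≡ y ∙ x
∙-comm x y = ∑ℤ.sum-cong-≗ λ i → ℤ.*-comm (x i) (y i)

∙-distribʳ-+ : ∀ {n} (x y z : Vector ℤ n) → (λ i → x i ℤ.+ y i) ∙ z ≡ x ∙ z ℤ.+ y ∙ z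
∙-distribʳ-+ x y z = trans (∑ℤ.sum-cong-≗ λ i → ℤ.*-distribʳ-+ (z i) (x i) (y i))
  (∑ℤ.∑-distrib-+ (λ i → x i ℤ.* z i) (λ i → y i ℤ.* z i))

∙-distribʳ-- : ∀ {n} (x y z : Vector ℤ n) → (λ i → x i ℤ.- y i) ∙ z ≡ x ∙ z ℤ.- y ∙ z
∙-distribʳ-- x y z = trans (∙-distribʳ-+ x (λ i → ℤ.- y i) z) (cong (ℤ._+_ (x ∙ z)) (∙-negˡ y z))

∙-distribˡ-+ : ∀ {n} (x y z : Vector ℤ n) → x ∙ (λ i → y i ℤ.+ z i) ≡ x ∙ y ℤ.+ x ∙ z
∙-distribˡ-+ x y z = trans (∙-comm x _)
  (trans (∙-distribʳ-+ y z x) (cong₂ ℤ._+_ (∙-comm y x) (∙-comm z x)))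

∙-distribˡ-- : ∀ {n} (x y z : Vector ℤ n) → x ∙ (λ i → y i ℤ.- z i) ≡ x ∙ y ℤ.- x ∙ z
∙-distribˡ-- x y z = trans (∙-comm x _)
  (trans (∙-distribʳ-- y z x) (cong₂ ℤ._-_ (∙-comm y x) (∙-comm z x)))

-- Hölder's inequality for the maximum norm and the ℓ¹-norm.
∣∙∣≤ : ∀ {n} B (x y : Vector ℤ n) → (∀ i → ℤ.∣ x i ∣ ℕ.≤ B) → ℤ.∣ x ∙ y ∣ ℕ.≤ B ℕ.* ‖ y ‖₁
∣∙∣≤ {zero} B x y x≤B = ℕ.z≤n
∣∙∣≤ {suc n} B x y x≤B = begin
  ℤ.∣ x ∙ y ∣
    ≤⟨ ℤ.∣i+j∣≤∣i∣+∣j∣ (x zero ℤ.* y zero) ((x ∘ suc) ∙ (y ∘ suc)) ⟩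
  ℤ.∣ x zero ℤ.* y zero ∣ ℕ.+ ℤ.∣ (x ∘ suc) ∙ (y ∘ suc) ∣
    ≡⟨ cong (ℕ._+ ℤ.∣ (x ∘ suc) ∙ (y ∘ suc) ∣) (ℤ.∣i*j∣≡∣i∣*∣j∣ (x zero) (y zero)) ⟩
  ℤ.∣ x zero ∣ ℕ.* ℤ.∣ y zero ∣ ℕ.+ ℤ.∣ (x ∘ suc) ∙ (y ∘ suc) ∣
    ≤⟨ ℕ.+-mono-≤ (ℕ.*-monoˡ-≤ ℤ.∣ y zero ∣ (x≤B zero)) (∣∙∣≤ B (x ∘ suc) (y ∘ suc) (x≤B ∘ suc)) ⟩
  B ℕ.* ℤ.∣ y zero ∣ ℕ.+ B ℕ.* ‖ y ∘ suc ‖₁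
    ≡⟨ ℕ.*-distribˡ-+ B ℤ.∣ y zero ∣ ‖ y ∘ suc ‖₁ ⟨
  B ℕ.* ‖ y ‖₁ ∎
  where open ℕ.≤-Reasoning

∣∣≤‖‖₁ : ∀ {n} (x : Vector ℤ n) i → ℤ.∣ x i ∣ ℕ.≤ ‖ x ‖₁
∣∣≤‖‖₁ x zero    = ℕ.m≤m+n ℤ.∣ x zero ∣ ‖ x ∘ suc ‖₁
∣∣≤‖‖₁ x (suc i) = ℕ.≤-trans (∣∣≤‖‖₁ (x ∘ suc) i) (ℕ.m≤n+m ‖ x ∘ suc ‖₁ ℤ.∣ x zero ∣)

-- The entrywise hypothesis covers sums and differences alike.
‖‖₁-triangle : ∀ {n} (x y z : Vector ℤ n) → (∀ i → ℤ.∣ z i ∣ ℕ.≤ ℤ.∣ x i ∣ ℕ.+ ℤ.∣ y i ∣) →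
  ‖ z ‖₁ ℕ.≤ ‖ x ‖₁ ℕ.+ ‖ y ‖₁
‖‖₁-triangle x y z z≤x+y = ℕ.≤-trans (sum-mono z≤x+y)
  (ℕ.≤-reflexive (∑ℕ.∑-distrib-+ (λ i → ℤ.∣ x i ∣) (λ i → ℤ.∣ y i ∣)))
  where
  sum-mono : ∀ {n} {f g : Vector ℕ n} → (∀ i → f i ℕ.≤ g i) → ∑ℕ.sum f ℕ.≤ ∑ℕ.sum g
  sum-mono {zero}  f≤g = ℕ.z≤n
  sum-mono {suc n} f≤g = ℕ.+-mono-≤ (f≤g zero) (sum-mono (f≤g ∘ suc))

powers : ∀ {n} → ℕ → Vector ℤ n
powers T i = (+ T) ℤ.^ toℕ i

-- Uniqueness of base-T digits, for digits between -T and T that represent 0.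
powers-separate : ∀ {n} T (b : Vector ℤ n) → (∀ i → ℤ.∣ b i ∣ ℕ.< T) →
  powers T ∙ b ≡ + 0 → ∀ i → b i ≡ + 0
powers-separate {suc n} T b b<T T∙b≡0 = λ
  { zero    → b₀≡0
  ; (suc i) → powers-separate T (b ∘ suc) (b<T ∘ suc) X≡0 i
  }
  where
  X : ℤ
  X = powers T ∙ (b ∘ suc)
  expand : powers T ∙ b ≡ b zero ℤ.+ + T ℤ.* X
  expand = cong₂ ℤ._+_ (ℤ.*-identityˡ (b zero)) (trans
    (∑ℤ.sum-cong-≗ λ i → ℤ.*-assoc (+ T) (powers T i) (b (suc i)))
    (sym (∑ℤ.*-distribˡ-sum (+ T) λ i → powers T i ℤ.* b (suc i))))
  b₀≡-TX : b zero ≡ ℤ.- (+ T ℤ.* X)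
  b₀≡-TX = inverseˡ-unique (b zero) (+ T ℤ.* X) (trans (sym expand) T∙b≡0)
    where open import Algebra.Properties.AbelianGroup ℤ.+-0-abelianGroup using (inverseˡ-unique)
  ∣b₀∣≡T∣X∣ : ℤ.∣ b zero ∣ ≡ T ℕ.* ℤ.∣ X ∣
  ∣b₀∣≡T∣X∣ = trans (cong ℤ.∣_∣ b₀≡-TX) (trans (ℤ.∣-i∣≡∣i∣ (+ T ℤ.* X)) (ℤ.∣i*j∣≡∣i∣*∣j∣ (+ T) X))
  -- The lowest digit is a multiple of T of absolute value less than T, so the cofactor X has to
  -- vanish.
  X≡0 : X ≡ + 0
  X≡0 with ℤ.∣ X ∣ in eq
  ... | zero  = ℤ.∣i∣≡0⇒i≡0 eq
  ... | suc k = contradiction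
    (subst (ℕ._< T) (trans ∣b₀∣≡T∣X∣ (cong (T ℕ.*_) eq)) (b<T zero)) (ℕ.≤⇒≯ (ℕ.m≤m*n T (suc k)))
  b₀≡0 : b zero ≡ + 0
  b₀≡0 = trans b₀≡-TX (cong ℤ.-_ (trans (cong (ℤ._*_ (+ T)) X≡0) (ℤ.*-zeroʳ (+ T))))

module _ {d n} (u : Vector (ℤ^ d) n) (spans : Spansℤ u) where

  private
    -- As a matrix, `c` is an integral left inverse of the matrix U with rows u i: cU is the
    -- identity.
    c : Fin d → Vector ℤ n
    c k = proj₁ (spans (e k))

    c-spans : ∀ k j → c k ∙ (λ i → u i j) ≡ e k j
    c-spans k = proj₂ (spans (e k))

  -- Replacing each unit vector in x = ∑ₖ xₖ eₖ by its integral combination of generators gives the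
  -- real coefficients xc.
  Spansℤ⇒Spansℝ : Spansℝ λ i → ι (u i)
  Spansℤ⇒Spansℝ x = t , λ j → termwise-≈ (lincomb t (λ i → ι (u i)) j) (x j) λ m → begin
    seq (lincomb t (λ i → ι (u i)) j) m
      ≡⟨ seq-∑ (λ i → t i * ι (u i) j) m ⟩
    ∑ℚ.sum (λ i → seq (t i) m ℚ.* ⟦ u i j ⟧)
      ≡⟨ ∑ℚ.sum-cong-≗ (λ i → cong (ℚ._* ⟦ u i j ⟧) (seq-∑ (λ k → x k * fromℤ (c k i)) m)) ⟩
    ∑ℚ.sum (λ i → ∑ℚ.sum (λ k → seq (x k) m ℚ.* ⟦ c k i ⟧) ℚ.* ⟦ u i j ⟧)
      ≡⟨ ∑ℚ.sum-*-assoc (λ k → seq (x k) m) (λ k i → ⟦ c k i ⟧) (λ i → ⟦ u i j ⟧) ⟩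
    ∑ℚ.sum (λ k → seq (x k) m ℚ.* ∑ℚ.sum (λ i → ⟦ c k i ⟧ ℚ.* ⟦ u i j ⟧))
      ≡⟨ ∑ℚ.sum-cong-≗ (λ k → cong (seq (x k) m ℚ.*_) (inner k j)) ⟩
    ∑ℚ.sum (λ k → seq (x k) m ℚ.* ⟦ e k j ⟧)
      ≡⟨ ∑ℚ.sum-unit (λ k → seq (x k) m) (λ k → ⟦ e k j ⟧) j
           (cong ⟦_⟧ (e-diagonal j)) (λ k k≢j → cong ⟦_⟧ (e-off-diagonal k≢j)) ⟩
    seq (x j) m ∎
    where
    open ≡-Reasoning
    t : Vector ℝ n
    t i = ∑ λ k → x k * fromℤ (c k i)
    inner : ∀ k j → ∑ℚ.sum (λ i → ⟦ c k i ⟧ ℚ.* ⟦ u i j ⟧) ≡ ⟦ e k j ⟧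
    inner k j = trans (∑ℚ.sum-cong-≗ λ i → sym (⟦⟧-homo-* (c k i) (u i j)))
      (trans (sym (⟦⟧-homo-∑ λ i → c k i ℤ.* u i j)) (cong ⟦_⟧ (c-spans k j)))

  -- Since ∑ᵢ c k i uᵢ = e k, the sum subtracted from τ is a second way to write
  -- the lattice point ∑ⱼ τⱼ uⱼ in the generators.
  relationFrom : Vector ℤ n → Vector ℤ n
  relationFrom τ i = τ i ℤ.- ∑ℤ λ k → τ ∙ (λ j → u j k) ℤ.* c k i

  -- The only z that can satisfy z ∙ u j = ℓ j for all j.
  dual : Vector ℤ n → ℤ^ d
  dual ℓ k = c k ∙ ℓ

  -- In matrix form `relationFrom τ` is τ(I - Uc) and `dual ℓ` is cℓ, so I - Uc can be moved from
  -- `τ` to `ℓ`.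
  relationFrom-∙ : ∀ τ ℓ → relationFrom τ ∙ ℓ ≡ τ ∙ λ j → ℓ j ℤ.- u j ∙ dual ℓ
  relationFrom-∙ τ ℓ = begin
    relationFrom τ ∙ ℓ
      ≡⟨ ∙-distribʳ-- τ (λ i → ∑ℤ λ k → s k ℤ.* c k i) ℓ ⟩
    τ ∙ ℓ ℤ.- (λ i → ∑ℤ λ k → s k ℤ.* c k i) ∙ ℓ
      ≡⟨ cong (ℤ._-_ (τ ∙ ℓ)) (∑ℤ.sum-*-assoc s c ℓ) ⟩
    τ ∙ ℓ ℤ.- s ∙ dual ℓ
      ≡⟨ cong (ℤ._-_ (τ ∙ ℓ)) (∑ℤ.sum-*-assoc τ u (dual ℓ)) ⟩
    τ ∙ ℓ ℤ.- τ ∙ (λ j → u j ∙ dual ℓ)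
      ≡⟨ ∙-distribˡ-- τ ℓ (λ j → u j ∙ dual ℓ) ⟨
    τ ∙ (λ j → ℓ j ℤ.- u j ∙ dual ℓ) ∎
    where
    open ≡-Reasoning
    s : ℤ^ d
    s k = τ ∙ λ j → u j k

  -- Because cU is the identity, (I - Uc)U = 0.
  relationFrom-relation : ∀ τ k → relationFrom τ ∙ (λ i → u i k) ≡ + 0
  relationFrom-relation τ k = trans (relationFrom-∙ τ (λ i → u i k)) (∑ℤ.sum-zero λ j →
    trans (cong (τ j ℤ.*_) (trans (cong (ℤ._-_ (u j k)) (u∙dual j)) (ℤ.+-inverseʳ (u j k))))
      (ℤ.*-zeroʳ (τ j)))
    where
    u∙dual : ∀ j → u j ∙ dual (λ i → u i k) ≡ u j k
    u∙dual j = ∑ℤ.sum-unit (u j) (dual λ i → u i k) k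
      (trans (c-spans k k) (e-diagonal k)) λ l l≢k → trans (c-spans l k) (e-off-diagonal l≢k)

  -- The bound is uniform in `ℓ`, so the powers of one base `T` serve all short vectors at once.
  remainder-bound : ∃ λ T → ∀ ℓ → ‖ ℓ ‖₁ ℕ.≤ 2 → ∀ j → ℤ.∣ ℓ j ℤ.- u j ∙ dual ℓ ∣ ℕ.< T
  -- Here γ bounds the entries of `c` and υ the norms of the generators. Entries of `ℓ` are at most
  -- 2, those of `dual ℓ` at most 2γ, hence the products at most 2γυ; `suc` makes the inequality
  -- strict.
  remainder-bound = suc (2 ℕ.+ γ ℕ.* 2 ℕ.* υ) , λ ℓ ℓ≤2 j → ℕ.s≤s (begin
    ℤ.∣ ℓ j ℤ.- u j ∙ dual ℓ ∣            ≤⟨ ℤ.∣i-j∣≤∣i∣+∣j∣ (ℓ j) (u j ∙ dual ℓ) ⟩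
    ℤ.∣ ℓ j ∣ ℕ.+ ℤ.∣ u j ∙ dual ℓ ∣      ≡⟨ cong (λ i → ℤ.∣ ℓ j ∣ ℕ.+ ℤ.∣ i ∣) (∙-comm (u j) (dual ℓ)) ⟩
    ℤ.∣ ℓ j ∣ ℕ.+ ℤ.∣ dual ℓ ∙ u j ∣
      ≤⟨ ℕ.+-mono-≤ (ℕ.≤-trans (∣∣≤‖‖₁ ℓ j) ℓ≤2) (∣∙∣≤ (γ ℕ.* 2) (dual ℓ) (u j) λ k →
           ℕ.≤-trans (∣∙∣≤ γ (c k) ℓ (c≤γ k)) (ℕ.*-monoʳ-≤ γ ℓ≤2)) ⟩
    2 ℕ.+ γ ℕ.* 2 ℕ.* ‖ u j ‖₁
      ≤⟨ ℕ.+-monoʳ-≤ 2 (ℕ.*-monoʳ-≤ (γ ℕ.* 2) (proj₂ (upper-bound λ j → ‖ u j ‖₁) j)) ⟩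
    2 ℕ.+ γ ℕ.* 2 ℕ.* υ                   ∎)
    where
    open ℕ.≤-Reasoning
    γ υ : ℕ
    γ = proj₁ (upper-bound λ k → ‖ c k ‖₁)
    υ = proj₁ (upper-bound λ j → ‖ u j ‖₁)
    c≤γ : ∀ k i → ℤ.∣ c k i ∣ ℕ.≤ γ
    c≤γ k i = ℕ.≤-trans (∣∣≤‖‖₁ (c k) i) (proj₂ (upper-bound λ k → ‖ c k ‖₁) k)

  -- If the relation made from the powers of `T` is orthogonal to a short `ℓ`, the remainders ℓⱼ -
  -- uⱼ·z with z = `dual ℓ` are base-T digits representing 0 and so vanish. Then the norm of `ℓ` is
  -- the width along `z`, which is at least 3.
  generic-relation : (∀ z → Nonzero z → 3 ℕ.≤ ‖ z ‖[ u ]) →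
    ∃ λ μ → (∀ k → μ ∙ (λ i → u i k) ≡ + 0) ×
      (∀ ℓ → Nonzero ℓ → ‖ ℓ ‖₁ ℕ.≤ 2 → μ ∙ ℓ ≢ + 0)
  generic-relation wide = relationFrom τ , relationFrom-relation τ , λ ℓ ℓ≢0 ℓ≤2 μ∙ℓ≡0 →
    let ℓ≡u∙z : ∀ j → ℓ j ≡ dual ℓ ∙ u j
        ℓ≡u∙z j = trans
          (ℤ.i-j≡0⇒i≡j (ℓ j) (u j ∙ dual ℓ) (powers-separate T (λ j → ℓ j ℤ.- u j ∙ dual ℓ)
            (proj₂ remainder-bound ℓ ℓ≤2) (trans (sym (relationFrom-∙ τ ℓ)) μ∙ℓ≡0) j))
          (∙-comm (u j) (dual ℓ))
        z≢0 : Nonzero (dual ℓ)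
        z≢0 z≡0 = ℓ≢0 λ j → trans (ℓ≡u∙z j) (∑ℤ.sum-zero λ k → cong (ℤ._* u j k) (z≡0 k))
    in ℕ.<⇒≱ (wide (dual ℓ) z≢0)
         (subst (ℕ._≤ 2) (∑ℕ.sum-cong-≗ λ j → cong ℤ.∣_∣ (ℓ≡u∙z j)) ℓ≤2)
    where
    T : ℕ
    T = proj₁ remainder-bound
    τ : Vector ℤ n
    τ = powers T

-- Cosimplicity from lattice-width at least three

width≥3⇒‖‖[]≥3 : ∀ {d n} (u : Vector (ℤ^ d) n) → LatticeWidth≥ (latticeZonotope u) 3ℝ →
  ∀ z → Nonzero z → 3 ℕ.≤ ‖ z ‖[ u ]
width≥3⇒‖‖[]≥3 u (w , (_ , w-minimal) , 3≤w) z z≢0 = ℤ.drop‿+≤+ (fromℤ-cancel-≤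
  (≤-trans 3ℝ w (fromℤ (+ ‖ z ‖[ u ])) 3≤w (w-minimal z z≢0 (fromℤ (+ ‖ z ‖[ u ])) (isWidthAlong u z))))

∣fromℤ∣-injective : ∀ a b → ∣ fromℤ a ∣ ≈ ∣ fromℤ b ∣ → a ≡ b ⊎ a ≡ ℤ.- b
∣fromℤ∣-injective a b ∣a∣≈∣b∣ = ∣∣≡⇒≡⊎≡- a b (ℤ.+-injective (fromℤ-injective (begin
  fromℤ (+ ℤ.∣ a ∣)      ≗⟨ (λ _ → sym (⟦⟧-∣∣ a)) ⟩
  ∣ fromℤ a ∣            ≈⟨ ∣a∣≈∣b∣ ⟩
  ∣ fromℤ b ∣            ≗⟨ (λ _ → ⟦⟧-∣∣ b) ⟩
  fromℤ (+ ℤ.∣ b ∣)      ∎)))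
  where
  open ≈-Reasoning
  ∣∣≡⇒≡⊎≡- : ∀ a b → ℤ.∣ a ∣ ≡ ℤ.∣ b ∣ → a ≡ b ⊎ a ≡ ℤ.- b
  ∣∣≡⇒≡⊎≡- (+ _)    (+ _)    refl = inj₁ refl
  ∣∣≡⇒≡⊎≡- (+ _)    -[1+ _ ] refl = inj₂ refl
  ∣∣≡⇒≡⊎≡- -[1+ _ ] (+ _)    refl = inj₂ refl
  ∣∣≡⇒≡⊎≡- -[1+ _ ] -[1+ _ ] refl = inj₁ refl

-- Genericity of the integer relation μ is tested on three kinds of short vectors: `e i` shows μᵢ
-- nonzero, while eᵢ - eⱼ and eᵢ + eⱼ exclude μᵢ = μⱼ and μᵢ = -μⱼ.
width≥3⇒cosimple : ∀ {d n} (u : Vector (ℤ^ d) n) → LatticeWidth≥ (latticeZonotope u) 3ℝ →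
  Spansℤ u → Cosimple u
width≥3⇒cosimple {d} {n} u width≥3 spans = record
  { spans    = Spansℤ⇒Spansℝ u spans
  ; coeff    = λ i → fromℤ (μ i)
  ; relation = λ k → begin
      lincomb (λ i → fromℤ (μ i)) (λ i → ι (u i)) k
        ≈⟨ ∑-cong (λ i → fromℤ (μ i) * fromℤ (u i k)) (λ i → fromℤ (μ i ℤ.* u i k))
             (λ i → termwise-≈ (fromℤ (μ i) * fromℤ (u i k)) (fromℤ (μ i ℤ.* u i k))
                λ _ → sym (⟦⟧-homo-* (μ i) (u i k))) ⟩
      ∑ (λ i → fromℤ (μ i ℤ.* u i k))      ≈⟨ ∑-fromℤ (λ i → μ i ℤ.* u i k) ⟩
      fromℤ (μ ∙ λ i → u i k)              ≡⟨ cong fromℤ (μ-relation k) ⟩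
      0ℝ                                   ∎
  ; nonzero  = λ i μᵢ≈0 → μ-generic (e i) (e-nonzero i)
      (subst (ℕ._≤ 2) (sym (‖e‖₁ i)) (ℕ.s≤s ℕ.z≤n)) (trans (∙-e μ i) (fromℤ-injective μᵢ≈0))
  ; distinct = λ i j i≢j ∣μᵢ∣≈∣μⱼ∣ → [ μᵢ≢μⱼ i j i≢j , μᵢ≢-μⱼ i j i≢j ]′
      (∣fromℤ∣-injective (μ i) (μ j) ∣μᵢ∣≈∣μⱼ∣)
  }
  where
  open ≈-Reasoning
  generic : ∃ λ μ → (∀ k → μ ∙ (λ i → u i k) ≡ + 0) ×
    (∀ ℓ → Nonzero ℓ → ‖ ℓ ‖₁ ℕ.≤ 2 → μ ∙ ℓ ≢ + 0)
  generic = generic-relation u spans (width≥3⇒‖‖[]≥3 u width≥3)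
  μ : Vector ℤ n
  μ = proj₁ generic
  μ-relation : ∀ k → μ ∙ (λ i → u i k) ≡ + 0
  μ-relation = proj₁ (proj₂ generic)
  μ-generic : ∀ ℓ → Nonzero ℓ → ‖ ℓ ‖₁ ℕ.≤ 2 → μ ∙ ℓ ≢ + 0
  μ-generic = proj₂ (proj₂ generic)

  ‖‖₁≤2 : ∀ i j (ℓ : Vector ℤ n) → (∀ k → ℤ.∣ ℓ k ∣ ℕ.≤ ℤ.∣ e i k ∣ ℕ.+ ℤ.∣ e j k ∣) → ‖ ℓ ‖₁ ℕ.≤ 2
  ‖‖₁≤2 i j ℓ ℓ≤ = subst (‖ ℓ ‖₁ ℕ.≤_) (cong₂ ℕ._+_ (‖e‖₁ i) (‖e‖₁ j)) (‖‖₁-triangle (e i) (e j) ℓ ℓ≤)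

  μᵢ≢μⱼ : ∀ i j → i ≢ j → μ i ≢ μ j
  μᵢ≢μⱼ i j i≢j μᵢ≡μⱼ = μ-generic (λ k → e i k ℤ.- e j k)
    (λ ℓ≡0 → contradiction (trans (sym (cong₂ ℤ._-_ (e-diagonal i) (e-off-diagonal (i≢j ∘ sym)))) (ℓ≡0 i)) λ ())
    (‖‖₁≤2 i j (λ k → e i k ℤ.- e j k) λ k → ℤ.∣i-j∣≤∣i∣+∣j∣ (e i k) (e j k))
    (trans (∙-distribˡ-- μ (e i) (e j))
      (trans (cong₂ ℤ._-_ (trans (∙-e μ i) μᵢ≡μⱼ) (∙-e μ j)) (ℤ.+-inverseʳ (μ j))))

  μᵢ≢-μⱼ : ∀ i j → i ≢ j → μ i ≢ ℤ.- μ j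
  μᵢ≢-μⱼ i j i≢j μᵢ≡-μⱼ = μ-generic (λ k → e i k ℤ.+ e j k)
    (λ ℓ≡0 → contradiction (trans (sym (cong₂ ℤ._+_ (e-diagonal i) (e-off-diagonal (i≢j ∘ sym)))) (ℓ≡0 i)) λ ())
    (‖‖₁≤2 i j (λ k → e i k ℤ.+ e j k) λ k → ℤ.∣i+j∣≤∣i∣+∣j∣ (e i k) (e j k))
    (trans (∙-distribˡ-+ μ (e i) (e j))
      (trans (cong₂ ℤ._+_ (trans (∙-e μ i) μᵢ≡-μⱼ) (∙-e μ j)) (ℤ.+-inverseˡ (μ j))))

corollary5p6 : (d : ℕ) .{{_ : NonZero d}} (n : ℕ) (u : Vector (ℤ^ d) n) →
    (Cosimple u → LatticeWidth≥ (latticeZonotope u) 3ℝ)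
    × (FullDimensional (latticeZonotope u) →
    LatticeWidth≥ (latticeZonotope u) 3ℝ →
    ¬ IsParallelepiped (latticeZonotope u) →
    Spansℤ u →
    Cosimple u)
corollary5p6 d n u =
  cosimple⇒width≥3 u , λ _ width≥3 _ spans → width≥3⇒cosimple u width≥3 spans
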